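{- Consider a class of problems of the form $\max\{F(S): S\subseteq[d],\ |S|\le k\}$ that satisfies the following conditions: $F:2^{[d]}\to\mathbb{R}$ is monotone (and normalized) and has submodularity ratio $\gamma_k=1$ and supermodularity ratio $\beta_k\ge\frac12-\Theta(1/k)$, where this lower bound tends to $\frac12$ as $k\to\infty$. For this class of problems, no algorithms that evaluate $F$ only on polynomially many subsets can achieve an approximation guarantee that exceeds $1-e^{ -1}=1-e^{ -\gamma_k}$ in general.
   Context: $d,k$ are positive integers and $[d]=\{1,\dots,d\}$; "polynomially many" means polynomial in $d$. For $F:2^{[d]}\to\mathbb{R}$ write $F(T\mid S):=F(S\cup T)-F(S)$ and $F(j\mid S):=F(\{j\}\mid S)$. $F$ is monotone if $F(T\mid S)\ge0$ for all $S,T\subseteq[d]$, and normalized if $F(\emptyset)=0$. Submodularity and supermodularity ratios: $\gamma_k$ and $\beta_k$ are the largest scalars in $[0,1]$ such that $$\gamma_k\,F(T\mid L)\ \le\ \sum_{j\in T}F(j\mid L)\ \le\ \beta_k^{ -1}\,F(T\mid L)$$ for all disjoint $L,T\subseteq[d]$ with $|L|\le k$ and $|T|\le k$. An algorithm accesses $F$ only by evaluating $F(S)$ on subsets $S\subseteq[d]$ of its choice (value oracle model). It achieves an approximation guarantee $\alpha$ if it outputs $S\subseteq[d]$ with $|S|\le k$ and $F(S)\ge\alpha\cdot\max\{F(S'):S'\subseteq[d],\ |S'|\le k\}$. -}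

module Defs where

open import Data.Fin.Base using (Fin)
open import Data.Fin.Subset using (Subset; ⊥; ⁅_⁆; _∪_; _∩_; ∣_∣; Empty)
open import Data.Fin.Subset.Properties using (_∈?_)
open import Data.Integer.Base as ℤ using (+_)
import Data.Integer.Properties as ℤ
open import Data.List.Base using (foldr; map; filter; allFin)
open import Data.Nat.Base as ℕ using (ℕ; zero; suc; NonZero)
import Data.Nat.Properties as ℕ
open import Data.Product.Base using (∃-syntax; _×_; _,_; proj₁; proj₂)
open import Data.Rational.Base as ℚ using (ℚ; mkℚ; 0ℚ; 1ℚ; ½; _/_; 1/_; *<*)
import Data.Rational.Properties as ℚ
import Data.Rational.Unnormalised.Base as ℚᵘ
import Data.Rational.Unnormalised.Properties as ℚᵘ
open import Data.Rational.Solver using (module +-*-Solver)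
open import Data.Sum.Base using (inj₁; inj₂)
open import Relation.Binary.PropositionalEquality
  using (_≡_; refl; sym; trans; cong; subst)

------------------------------------------------------------------------
-- Real numbers, as Cauchy sequences of rationals up to _≈ℝ_

IsCauchy : (ℕ → ℚ) → Set
IsCauchy x = ∀ ε → 0ℚ ℚ.< ε →
  ∃[ N ] (∀ m n → N ℕ.≤ m → N ℕ.≤ n → ℚ.∣ x m ℚ.- x n ∣ ℚ.≤ ε)

record ℝ : Set where
  constructor mkℝ
  field
    seq    : ℕ → ℚ
    cauchy : IsCauchy seq

open ℝ public

infix  4 _≤ℝ_ _<ℝ_ _≈ℝ_
infixl 6 _+ℝ_ _-ℝ_
infixl 7 _*ℝ_
infix  8 -ℝ_

_≤ℝ_ : ℝ → ℝ → Set
x ≤ℝ y = ∀ ε → 0ℚ ℚ.< ε → ∃[ N ] (∀ n → N ℕ.≤ n → seq x n ℚ.≤ seq y n ℚ.+ ε)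

_<ℝ_ : ℝ → ℝ → Set
x <ℝ y = ∃[ ε ] 0ℚ ℚ.< ε × ∃[ N ] (∀ n → N ℕ.≤ n → seq x n ℚ.+ ε ℚ.≤ seq y n)

_≈ℝ_ : ℝ → ℝ → Set
x ≈ℝ y = x ≤ℝ y × y ≤ℝ x

private
  ½-pos : ∀ ε → 0ℚ ℚ.< ε → 0ℚ ℚ.< ½ ℚ.* ε
  ½-pos ε ε>0 = ℚ.*-monoʳ-<-pos ½ ε>0

  half+half : ∀ ε → ½ ℚ.* ε ℚ.+ ½ ℚ.* ε ≡ ε
  half+half ε = trans (sym (ℚ.*-distribʳ-+ ε ½ ½)) (ℚ.*-identityˡ ε)

abstract
  const-isCauchy : ∀ q → IsCauchy (λ _ → q)
  const-isCauchy q ε ε>0 =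
    0 , λ _ _ _ _ → subst (λ z → ℚ.∣ z ∣ ℚ.≤ ε) (sym (ℚ.+-inverseʳ q)) (ℚ.<⇒≤ ε>0)

fromℚ : ℚ → ℝ
fromℚ q = mkℝ (λ _ → q) (const-isCauchy q)

0ℝ 1ℝ ½ℝ : ℝ
0ℝ = fromℚ 0ℚ
1ℝ = fromℚ 1ℚ
½ℝ = fromℚ ½

abstract
  +-isCauchy : ∀ x y → IsCauchy (λ n → seq x n ℚ.+ seq y n)
  +-isCauchy x y ε ε>0 =
    let (M , xc) = cauchy x (½ ℚ.* ε) (½-pos ε ε>0)
        (N , yc) = cauchy y (½ ℚ.* ε) (½-pos ε ε>0)
    in M ℕ.⊔ N , λ m n ≤m ≤n → begin
      ℚ.∣ (seq x m ℚ.+ seq y m) ℚ.- (seq x n ℚ.+ seq y n) ∣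
        ≡⟨ cong ℚ.∣_∣ (rearrange (seq x m) (seq y m) (seq x n) (seq y n)) ⟩
      ℚ.∣ (seq x m ℚ.- seq x n) ℚ.+ (seq y m ℚ.- seq y n) ∣
        ≤⟨ ℚ.∣p+q∣≤∣p∣+∣q∣ (seq x m ℚ.- seq x n) (seq y m ℚ.- seq y n) ⟩
      ℚ.∣ seq x m ℚ.- seq x n ∣ ℚ.+ ℚ.∣ seq y m ℚ.- seq y n ∣
        ≤⟨ ℚ.+-mono-≤ (xc m n (ℕ.m⊔n≤o⇒m≤o M N ≤m) (ℕ.m⊔n≤o⇒m≤o M N ≤n))
                      (yc m n (ℕ.m⊔n≤o⇒n≤o M N ≤m) (ℕ.m⊔n≤o⇒n≤o M N ≤n)) ⟩
      ½ ℚ.* ε ℚ.+ ½ ℚ.* ε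
        ≡⟨ half+half ε ⟩
      ε ∎
    where
    open ℚ.≤-Reasoning
    rearrange : ∀ a b c d → (a ℚ.+ b) ℚ.- (c ℚ.+ d) ≡ (a ℚ.- c) ℚ.+ (b ℚ.- d)
    rearrange = solve 4 (λ a b c d → (a :+ b) :- (c :+ d) := (a :- c) :+ (b :- d)) refl
      where open +-*-Solver

_+ℝ_ : ℝ → ℝ → ℝ
x +ℝ y = mkℝ (λ n → seq x n ℚ.+ seq y n) (+-isCauchy x y)

abstract
  neg-isCauchy : ∀ x → IsCauchy (λ n → ℚ.- seq x n)
  neg-isCauchy x ε ε>0 =
    let (N , xc) = cauchy x ε ε>0
    in N , λ m n ≤m ≤n → subst (ℚ._≤ ε)
         (trans (sym (ℚ.∣-p∣≡∣p∣ (seq x m ℚ.- seq x n)))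
                (cong ℚ.∣_∣ (ℚ.neg-distrib-+ (seq x m) (ℚ.- seq x n))))
         (xc m n ≤m ≤n)

-ℝ_ : ℝ → ℝ
-ℝ x = mkℝ (λ n → ℚ.- seq x n) (neg-isCauchy x)

_-ℝ_ : ℝ → ℝ → ℝ
x -ℝ y = x +ℝ (-ℝ y)

private
  eventuallyBounded : ∀ x → ∃[ B ] 0ℚ ℚ.< B ×
    ∃[ N ] (∀ n → N ℕ.≤ n → ℚ.∣ seq x n ∣ ℚ.≤ B)
  eventuallyBounded x =
    let (N , xc) = cauchy x 1ℚ (ℚ.positive⁻¹ 1ℚ)
        xN = seq x N
    in ℚ.∣ xN ∣ ℚ.+ 1ℚ ,
       ℚ.+-mono-≤-< (ℚ.0≤∣p∣ xN) (ℚ.positive⁻¹ 1ℚ) ,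
       N , λ n N≤n → begin
         ℚ.∣ seq x n ∣                              ≡⟨ cong ℚ.∣_∣ (split (seq x n) xN) ⟩
         ℚ.∣ xN ℚ.+ (seq x n ℚ.- xN) ∣              ≤⟨ ℚ.∣p+q∣≤∣p∣+∣q∣ xN (seq x n ℚ.- xN) ⟩
         ℚ.∣ xN ∣ ℚ.+ ℚ.∣ seq x n ℚ.- xN ∣          ≤⟨ ℚ.+-monoʳ-≤ ℚ.∣ xN ∣ (xc n N N≤n ℕ.≤-refl) ⟩
         ℚ.∣ xN ∣ ℚ.+ 1ℚ                            ∎
    where
    open ℚ.≤-Reasoning
    split : ∀ a b → a ≡ b ℚ.+ (a ℚ.- b)
    split = solve 2 (λ a b → a := b :+ (a :- b)) refl
      where open +-*-Solver

  *-mono-≤-abs : ∀ {p q B δ} → ℚ.∣ p ∣ ℚ.≤ B → ℚ.∣ q ∣ ℚ.≤ δ → ℚ.∣ p ℚ.* q ∣ ℚ.≤ B ℚ.* δ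
  *-mono-≤-abs {p} {q} {B} {δ} p≤B q≤δ = begin
    ℚ.∣ p ℚ.* q ∣            ≡⟨ ℚ.∣p*q∣≡∣p∣*∣q∣ p q ⟩
    ℚ.∣ p ∣ ℚ.* ℚ.∣ q ∣      ≤⟨ ℚ.*-monoʳ-≤-nonNeg ℚ.∣ q ∣ {{ℚ.∣-∣-nonNeg q}} p≤B ⟩
    B ℚ.* ℚ.∣ q ∣            ≤⟨ ℚ.*-monoˡ-≤-nonNeg B {{ℚ.nonNegative (ℚ.≤-trans (ℚ.0≤∣p∣ p) p≤B)}} q≤δ ⟩
    B ℚ.* δ                  ∎
    where open ℚ.≤-Reasoning

abstract
  *-isCauchy : ∀ x y → IsCauchy (λ n → seq x n ℚ.* seq y n)
  *-isCauchy x y ε ε>0 =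
    let (Bx , Bx>0 , Nx , x≤Bx) = eventuallyBounded x
        (By , By>0 , Ny , y≤By) = eventuallyBounded y
        B = Bx ℚ.+ By
        B⁺ = ℚ.positive (ℚ.+-mono-< Bx>0 By>0)
        B≢0 = ℚ.pos⇒nonZero B {{B⁺}}
        1/B = (1/ B) {{B≢0}}
        δ = 1/B ℚ.* ε
        δ>0 = subst (ℚ._< δ) (ℚ.*-zeroʳ 1/B)
                (ℚ.*-monoʳ-<-pos 1/B {{ℚ.1/pos⇒pos B {{B⁺}}}} ε>0)
        (Mx , xc) = cauchy x δ δ>0
        (My , yc) = cauchy y δ δ>0
        N = (Nx ℕ.⊔ Ny) ℕ.⊔ (Mx ℕ.⊔ My)
    in N , λ m n ≤m ≤n →
      let lN≤m = ℕ.m⊔n≤o⇒m≤o (Nx ℕ.⊔ Ny) (Mx ℕ.⊔ My) ≤m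
          lN≤n = ℕ.m⊔n≤o⇒m≤o (Nx ℕ.⊔ Ny) (Mx ℕ.⊔ My) ≤n
          lM≤m = ℕ.m⊔n≤o⇒n≤o (Nx ℕ.⊔ Ny) (Mx ℕ.⊔ My) ≤m
          lM≤n = ℕ.m⊔n≤o⇒n≤o (Nx ℕ.⊔ Ny) (Mx ℕ.⊔ My) ≤n
          xm = seq x m ; xn = seq x n ; ym = seq y m ; yn = seq y n
      in begin
        ℚ.∣ xm ℚ.* ym ℚ.- xn ℚ.* yn ∣
          ≡⟨ cong ℚ.∣_∣ (rearrange xm ym xn yn) ⟩
        ℚ.∣ xm ℚ.* (ym ℚ.- yn) ℚ.+ yn ℚ.* (xm ℚ.- xn) ∣
          ≤⟨ ℚ.∣p+q∣≤∣p∣+∣q∣ (xm ℚ.* (ym ℚ.- yn)) (yn ℚ.* (xm ℚ.- xn)) ⟩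
        ℚ.∣ xm ℚ.* (ym ℚ.- yn) ∣ ℚ.+ ℚ.∣ yn ℚ.* (xm ℚ.- xn) ∣
          ≤⟨ ℚ.+-mono-≤
               (*-mono-≤-abs {xm} {ym ℚ.- yn} (x≤Bx m (ℕ.m⊔n≤o⇒m≤o Nx Ny lN≤m))
                 (yc m n (ℕ.m⊔n≤o⇒n≤o Mx My lM≤m) (ℕ.m⊔n≤o⇒n≤o Mx My lM≤n)))
               (*-mono-≤-abs {yn} {xm ℚ.- xn} (y≤By n (ℕ.m⊔n≤o⇒n≤o Nx Ny lN≤n))
                 (xc m n (ℕ.m⊔n≤o⇒m≤o Mx My lM≤m) (ℕ.m⊔n≤o⇒m≤o Mx My lM≤n))) ⟩
        Bx ℚ.* δ ℚ.+ By ℚ.* δ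
          ≡⟨ sym (ℚ.*-distribʳ-+ δ Bx By) ⟩
        B ℚ.* (1/B ℚ.* ε)
          ≡⟨ sym (ℚ.*-assoc B 1/B ε) ⟩
        (B ℚ.* 1/B) ℚ.* ε
          ≡⟨ cong (ℚ._* ε) (ℚ.*-inverseʳ B {{B≢0}}) ⟩
        1ℚ ℚ.* ε
          ≡⟨ ℚ.*-identityˡ ε ⟩
        ε ∎
    where
    open ℚ.≤-Reasoning
    rearrange : ∀ a b c d → a ℚ.* b ℚ.- c ℚ.* d ≡ a ℚ.* (b ℚ.- d) ℚ.+ d ℚ.* (a ℚ.- c)
    rearrange = solve 4 (λ a b c d → a :* b :- c :* d := a :* (b :- d) :+ d :* (a :- c)) refl
      where open +-*-Solver

_*ℝ_ : ℝ → ℝ → ℝ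
x *ℝ y = mkℝ (λ n → seq x n ℚ.* seq y n) (*-isCauchy x y)

------------------------------------------------------------------------
-- e⁻¹ = Σᵢ (-1)ⁱ / i!

-- (-1)ⁱ / i!
expTerm : ℕ → ℚ
expTerm zero    = 1ℚ
expTerm (suc i) = ℚ.- (expTerm i ℚ.* (+ 1 / suc i))

expPartialSum : ℕ → ℚ
expPartialSum zero    = 0ℚ
expPartialSum (suc n) = expPartialSum n ℚ.+ expTerm n

private
  unit : ℕ → ℚ
  unit i = + 1 / suc i

  toℚᵘ-unit : ∀ i → ℚ.toℚᵘ (unit i) ℚᵘ.≃ ℚᵘ.mkℚᵘ (+ 1) i
  toℚᵘ-unit i = ℚ.toℚᵘ-fromℚᵘ (ℚᵘ.mkℚᵘ (+ 1) i)

  unit-antitone : ∀ i j → i ℕ.≤ j → unit j ℚ.≤ unit i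
  unit-antitone i j i≤j = ℚ.toℚᵘ-cancel-≤ (begin
    ℚ.toℚᵘ (unit j)       ≃⟨ toℚᵘ-unit j ⟩
    ℚᵘ.mkℚᵘ (+ 1) j       ≤⟨ ℚᵘ.*≤* (ℤ.*-monoˡ-≤-nonNeg (+ 1) (ℤ.+≤+ (ℕ.s≤s i≤j))) ⟩
    ℚᵘ.mkℚᵘ (+ 1) i       ≃⟨ ℚᵘ.≃-sym (toℚᵘ-unit i) ⟩
    ℚ.toℚᵘ (unit i)       ∎)
    where open ℚᵘ.≤-Reasoning

  archimedean : ∀ ε → 0ℚ ℚ.< ε → ∃[ n ] unit n ℚ.≤ ε
  archimedean (mkℚ (+ zero) d c) (*<* (ℤ.+<+ ()))
  archimedean (mkℚ (ℤ.-[1+ _ ]) d c) (*<* ())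
  archimedean (mkℚ (+ suc p) d c) _ = d , ℚ.toℚᵘ-cancel-≤ (begin
    ℚ.toℚᵘ (unit d)       ≃⟨ toℚᵘ-unit d ⟩
    ℚᵘ.mkℚᵘ (+ 1) d       ≤⟨ ℚᵘ.*≤* (ℤ.*-monoʳ-≤-nonNeg (+ suc d) (ℤ.+≤+ (ℕ.s≤s (ℕ.z≤n {p})))) ⟩
    ℚᵘ.mkℚᵘ (+ suc p) d   ∎)
    where open ℚᵘ.≤-Reasoning

  ∣unit∣ : ∀ i → ℚ.∣ unit i ∣ ≡ unit i
  ∣unit∣ i = ℚ.0≤p⇒∣p∣≡p (ℚ.<⇒≤ (ℚ.positive⁻¹ (unit i) {{ℚ.normalize-pos 1 (suc i)}}))

  ∣expTerm∣-suc : ∀ i → ℚ.∣ expTerm (suc i) ∣ ≡ ℚ.∣ expTerm i ∣ ℚ.* unit i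
  ∣expTerm∣-suc i = trans (ℚ.∣-p∣≡∣p∣ (expTerm i ℚ.* unit i))
    (trans (ℚ.∣p*q∣≡∣p∣*∣q∣ (expTerm i) (unit i))
           (cong (ℚ.∣ expTerm i ∣ ℚ.*_) (∣unit∣ i)))

  ∣expTerm∣-bound : ∀ i q → unit i ℚ.≤ q → ℚ.∣ expTerm (suc i) ∣ ℚ.≤ ℚ.∣ expTerm i ∣ ℚ.* q
  ∣expTerm∣-bound i q u≤q = subst (ℚ._≤ ℚ.∣ expTerm i ∣ ℚ.* q) (sym (∣expTerm∣-suc i))
    (ℚ.*-monoˡ-≤-nonNeg ℚ.∣ expTerm i ∣ {{ℚ.∣-∣-nonNeg (expTerm i)}} u≤q)

  ∣expTerm∣≤1 : ∀ i → ℚ.∣ expTerm i ∣ ℚ.≤ 1ℚ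
  ∣expTerm∣≤1 zero    = ℚ.≤-refl
  ∣expTerm∣≤1 (suc i) = ℚ.≤-trans (∣expTerm∣-bound i 1ℚ (unit-antitone 0 i ℕ.z≤n))
    (subst (ℚ._≤ 1ℚ) (sym (ℚ.*-identityʳ ℚ.∣ expTerm i ∣)) (∣expTerm∣≤1 i))

  ∣expTerm∣≤unit : ∀ i → ℚ.∣ expTerm (suc i) ∣ ℚ.≤ unit i
  ∣expTerm∣≤unit i = begin
    ℚ.∣ expTerm (suc i) ∣      ≡⟨ ∣expTerm∣-suc i ⟩
    ℚ.∣ expTerm i ∣ ℚ.* unit i
      ≤⟨ ℚ.*-monoʳ-≤-nonNeg (unit i) {{ℚ.normalize-nonNeg 1 (suc i)}} (∣expTerm∣≤1 i) ⟩
    1ℚ ℚ.* unit i              ≡⟨ ℚ.*-identityˡ (unit i) ⟩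
    unit i                     ∎
    where open ℚ.≤-Reasoning

  double-∣expTerm∣ : ∀ n → ℚ.∣ expTerm (2 ℕ.+ n) ∣ ℚ.+ ℚ.∣ expTerm (2 ℕ.+ n) ∣ ℚ.≤ ℚ.∣ expTerm (suc n) ∣
  double-∣expTerm∣ n = begin
    ∣t∣ ℚ.+ ∣t∣                  ≤⟨ ℚ.+-mono-≤ t≤ t≤ ⟩
    ∣s∣ ℚ.* ½ ℚ.+ ∣s∣ ℚ.* ½      ≡⟨ sym (ℚ.*-distribˡ-+ ∣s∣ ½ ½) ⟩
    ∣s∣ ℚ.* 1ℚ                   ≡⟨ ℚ.*-identityʳ ∣s∣ ⟩
    ∣s∣                          ∎
    where
    open ℚ.≤-Reasoning
    ∣s∣ = ℚ.∣ expTerm (suc n) ∣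
    ∣t∣ = ℚ.∣ expTerm (2 ℕ.+ n) ∣
    t≤ : ∣t∣ ℚ.≤ ∣s∣ ℚ.* ½
    t≤ = ∣expTerm∣-bound (suc n) ½ (unit-antitone 1 (suc n) (ℕ.s≤s ℕ.z≤n))

  expTail : ∀ k n → ℚ.∣ expPartialSum (k ℕ.+ suc n) ℚ.- expPartialSum (suc n) ∣
                    ℚ.≤ ℚ.∣ expTerm (suc n) ∣ ℚ.+ ℚ.∣ expTerm (suc n) ∣
  expTail zero n = begin
    ℚ.∣ expPartialSum (suc n) ℚ.- expPartialSum (suc n) ∣
      ≡⟨ cong ℚ.∣_∣ (ℚ.+-inverseʳ (expPartialSum (suc n))) ⟩
    0ℚ ℚ.+ 0ℚ
      ≤⟨ ℚ.+-mono-≤ (ℚ.0≤∣p∣ (expTerm (suc n))) (ℚ.0≤∣p∣ (expTerm (suc n))) ⟩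
    ℚ.∣ expTerm (suc n) ∣ ℚ.+ ℚ.∣ expTerm (suc n) ∣ ∎
    where open ℚ.≤-Reasoning
  expTail (suc k) n = begin
    ℚ.∣ expPartialSum (suc k ℕ.+ suc n) ℚ.- a ∣
      ≡⟨ cong (λ i → ℚ.∣ expPartialSum i ℚ.- a ∣) (sym (ℕ.+-suc k (suc n))) ⟩
    ℚ.∣ b ℚ.- a ∣
      ≡⟨ cong ℚ.∣_∣ (split b a t) ⟩
    ℚ.∣ t ℚ.+ (b ℚ.- (a ℚ.+ t)) ∣
      ≤⟨ ℚ.∣p+q∣≤∣p∣+∣q∣ t (b ℚ.- (a ℚ.+ t)) ⟩
    ℚ.∣ t ∣ ℚ.+ ℚ.∣ b ℚ.- (a ℚ.+ t) ∣
      ≤⟨ ℚ.+-monoʳ-≤ ℚ.∣ t ∣ (ℚ.≤-trans (expTail k (suc n)) (double-∣expTerm∣ n)) ⟩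
    ℚ.∣ t ∣ ℚ.+ ℚ.∣ t ∣ ∎
    where
    open ℚ.≤-Reasoning
    a = expPartialSum (suc n)
    b = expPartialSum (k ℕ.+ suc (suc n))
    t = expTerm (suc n)
    split : ∀ b a t → b ℚ.- a ≡ t ℚ.+ (b ℚ.- (a ℚ.+ t))
    split = solve 3 (λ b a t → b :- a := t :+ (b :- (a :+ t))) refl
      where open +-*-Solver

  ∣-∣-comm : ∀ p q → ℚ.∣ p ℚ.- q ∣ ≡ ℚ.∣ q ℚ.- p ∣
  ∣-∣-comm p q = trans (sym (ℚ.∣-p∣≡∣p∣ (p ℚ.- q)))
    (cong ℚ.∣_∣ (solve 2 (λ p q → :- (p :- q) := q :- p) refl p q))
    where open +-*-Solver

abstract
  expPartialSum-isCauchy : IsCauchy expPartialSum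
  expPartialSum-isCauchy ε ε>0 = suc N , bound
    where
    open ℚ.≤-Reasoning
    N : ℕ
    N = proj₁ (archimedean (½ ℚ.* ε) (½-pos ε ε>0))

    bound-≤ : ∀ m n → suc N ℕ.≤ m → m ℕ.≤ n →
              ℚ.∣ expPartialSum n ℚ.- expPartialSum m ∣ ℚ.≤ ε
    bound-≤ (suc m) n (ℕ.s≤s N≤m) m<n = begin
      ℚ.∣ expPartialSum n ℚ.- expPartialSum (suc m) ∣
        ≡⟨ cong (λ i → ℚ.∣ expPartialSum i ℚ.- expPartialSum (suc m) ∣) (sym (ℕ.m∸n+n≡m m<n)) ⟩
      ℚ.∣ expPartialSum ((n ℕ.∸ suc m) ℕ.+ suc m) ℚ.- expPartialSum (suc m) ∣
        ≤⟨ expTail (n ℕ.∸ suc m) m ⟩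
      ℚ.∣ expTerm (suc m) ∣ ℚ.+ ℚ.∣ expTerm (suc m) ∣
        ≤⟨ ℚ.+-mono-≤ t≤ t≤ ⟩
      ½ ℚ.* ε ℚ.+ ½ ℚ.* ε
        ≡⟨ half+half ε ⟩
      ε ∎
      where
      t≤ : ℚ.∣ expTerm (suc m) ∣ ℚ.≤ ½ ℚ.* ε
      t≤ = ℚ.≤-trans (∣expTerm∣≤unit m)
             (ℚ.≤-trans (unit-antitone N m N≤m) (proj₂ (archimedean (½ ℚ.* ε) (½-pos ε ε>0))))

    bound : ∀ m n → suc N ℕ.≤ m → suc N ℕ.≤ n →
            ℚ.∣ expPartialSum m ℚ.- expPartialSum n ∣ ℚ.≤ ε
    bound m n N<m N<n with ℕ.≤-total n m
    ... | inj₁ n≤m = bound-≤ n m N<n n≤m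
    ... | inj₂ m≤n = subst (ℚ._≤ ε) (∣-∣-comm (expPartialSum n) (expPartialSum m)) (bound-≤ m n N<m m≤n)

e⁻¹ : ℝ
e⁻¹ = mkℝ expPartialSum expPartialSum-isCauchy

------------------------------------------------------------------------
-- Set functions

SetFunction : ℕ → Set
SetFunction d = Subset d → ℝ

-- marginal F T S is F(T ∣ S)
marginal : ∀ {d} → SetFunction d → Subset d → Subset d → ℝ
marginal F T S = F (S ∪ T) -ℝ F S

∑[_] : ∀ {d} → Subset d → (Fin d → ℝ) → ℝ
∑[_] {d} T f = foldr _+ℝ_ 0ℝ (map f (filter (_∈? T) (allFin d)))

Monotone : ∀ {d} → SetFunction d → Set
Monotone F = ∀ S T → 0ℝ ≤ℝ marginal F T S

Normalized : ∀ {d} → SetFunction d → Set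
Normalized F = F ⊥ ≈ℝ 0ℝ

-- x is the largest element of { y ∈ [0,1] : P y }
IsLargestInUnitInterval : (ℝ → Set) → ℝ → Set
IsLargestInUnitInterval P x = Admissible x × (∀ y → Admissible y → y ≤ℝ x)
  where
  Admissible : ℝ → Set
  Admissible y = 0ℝ ≤ℝ y × y ≤ℝ 1ℝ × P y

SubmodularityInequality : ∀ {d} → SetFunction d → ℕ → ℝ → Set
SubmodularityInequality F k γ =
  ∀ L T → Empty (L ∩ T) → ∣ L ∣ ℕ.≤ k → ∣ T ∣ ℕ.≤ k →
  γ *ℝ marginal F T L ≤ℝ ∑[ T ] (λ j → marginal F ⁅ j ⁆ L)

-- ∑ⱼ F(j ∣ L) ≤ β⁻¹ F(T ∣ L), multiplied through by β so that it also makes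
-- sense for β = 0, where it imposes no constraint on a monotone F.
SupermodularityInequality : ∀ {d} → SetFunction d → ℕ → ℝ → Set
SupermodularityInequality F k β =
  ∀ L T → Empty (L ∩ T) → ∣ L ∣ ℕ.≤ k → ∣ T ∣ ℕ.≤ k →
  β *ℝ ∑[ T ] (λ j → marginal F ⁅ j ⁆ L) ≤ℝ marginal F T L

IsSubmodularityRatio : ∀ {d} → SetFunction d → ℕ → ℝ → Set
IsSubmodularityRatio F k = IsLargestInUnitInterval (SubmodularityInequality F k)

IsSupermodularityRatio : ∀ {d} → SetFunction d → ℕ → ℝ → Set
IsSupermodularityRatio F k = IsLargestInUnitInterval (SupermodularityInequality F k)

------------------------------------------------------------------------
-- The problem class

-- b(k) = ½ - Θ(1/k); the upper bound on ½ - b(k) forces b(k) → ½.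
IsHalfMinusΘ[1/k] : (ℕ → ℝ) → Set
IsHalfMinusΘ[1/k] b =
  ∃[ c₁ ] ∃[ c₂ ] ∃[ k₀ ] 0ℝ <ℝ c₁ × 0ℝ <ℝ c₂ ×
  (∀ k .{{_ : NonZero k}} → k₀ ℕ.≤ k →
    c₁ *ℝ fromℚ (+ 1 / k) ≤ℝ ½ℝ -ℝ b k × ½ℝ -ℝ b k ≤ℝ c₂ *ℝ fromℚ (+ 1 / k))

-- Membership of max { F(S) : ∣S∣ ≤ k } in the class with β_k ≥ b(k).
record InClass (b : ℕ → ℝ) {d : ℕ} (k : ℕ) (F : SetFunction d) : Set where
  field
    monotone             : Monotone F
    normalized           : Normalized F
    submodularityRatio   : IsSubmodularityRatio F k 1ℝ
    supermodularityRatio : ∃[ β ] IsSupermodularityRatio F k β × b k ≤ℝ β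

------------------------------------------------------------------------
-- Algorithms in the value oracle model

-- Adaptive deterministic algorithms on a ground set of size d: either stop
-- with an output, or query a set and continue depending on its value.
data Strategy (d : ℕ) : Set where
  output : Subset d → Strategy d
  query  : Subset d → (ℝ → Strategy d) → Strategy d

run : ∀ {d} → Strategy d → SetFunction d → Subset d
run (output S)  F = S
run (query S κ) F = run (κ (F S)) F

queryCount : ∀ {d} → Strategy d → SetFunction d → ℕ
queryCount (output S)  F = 0
queryCount (query S κ) F = suc (queryCount (κ (F S)) F)

Algorithm : Set
Algorithm = (d k : ℕ) → Strategy d

PolynomiallyManyQueries : (ℕ → ℝ) → Algorithm → Set
PolynomiallyManyQueries b A =
  ∃[ c ] ∃[ r ] ∀ d k → .{{NonZero d}} → .{{NonZero k}} →
  (F : SetFunction d) → InClass b k F → queryCount (A d k) F ℕ.≤ c ℕ.* d ℕ.^ r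

IsMaximum : ∀ {d} → SetFunction d → ℕ → ℝ → Set
IsMaximum F k v =
  (∃[ S ] ∣ S ∣ ℕ.≤ k × F S ≈ℝ v) × (∀ S → ∣ S ∣ ℕ.≤ k → F S ≤ℝ v)

AchievesGuarantee : (ℕ → ℝ) → Algorithm → ℝ → Set
AchievesGuarantee b A α =
  ∀ d k → .{{NonZero d}} → .{{NonZero k}} →
  (F : SetFunction d) → InClass b k F →
  let S = run (A d k) F in
  ∣ S ∣ ℕ.≤ k × (∀ v → IsMaximum F k v → α *ℝ v ≤ℝ F S)

{-# OPTIONS --safe #-}

-- The optimum is hidden in a random k-set O. Put κ = 1/k and, for a set S with
-- a elements in O and c elements outside it,
--   F(S) = 1 - (1 - (a ∸ r)κ)(1 - κ)^(min(a,r) + c).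
-- The first r elements of O thus behave like all other elements; afterwards an
-- element of O still removes the fixed fraction κ of the initial mass, and any
-- other element the fraction κ of what is left. Bernoulli's inequality gives
-- γ_k = 1, and (1 - κ)ʷ ≤ 1 - wκ/2 for w ≤ k gives β_k ≥ ½. Here F(O) ≥ 1 - rκ,
-- but a set of size at most k meeting O in at most r elements has value at most
-- 1 - (1 - κ)ᵏ, which tends to 1 - e⁻¹. If an algorithm makes at most c dʳ
-- queries, then for fixed k and large d some O meets each of its small queries
-- in at most r elements, by a union bound over r + 1 hits, so that the algorithm
-- cannot tell O from the empty set.

module Submission where

open import Defs
open import Algebra.Bundles using (CommutativeRing)
open import Data.Bool.Base using (true; false; if_then_else_; _∧_)
open import Data.Empty using (⊥-elim)
open import Data.Fin.Base using (Fin; zero; suc)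
open import Data.Fin.Subset
  using (Subset; ⊥; ⁅_⁆; _∪_; _∩_; ∁; Empty; inside; outside; _∈_; _∉_) renaming (∣_∣ to ∥_∥)
open import Data.Fin.Subset.Properties
  using (_∈?_; nonempty?; drop-∷-Empty; ∩-zeroˡ; ∩-zeroʳ; ∩-comm; ∩-idem; ∣⊥∣≡0; ∣⁅x⁆∣≡1; x∈⁅y⁆⇒x≡y;
         x∈p∩q⁺; x∈p∩q⁻; x∈∁p⇒x∉p; x∉p⇒x∈∁p; p⊆q⇒∣p∣≤∣q∣; p⊆p∪q; ∣p∣≤∣p∪q∣; ∣p∩q∣≤∣q∣)
open import Data.Integer.Base as ℤ using (+_)
import Data.Integer.Properties as ℤ
open import Data.List.Base
  using (List; []; _∷_; foldr; filter; allFin; tabulate; map; cartesianProduct; length)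
  renaming (_++_ to _++ˡ_)
open import Data.List.Membership.Propositional using () renaming (_∈_ to _∈ˡ_)
open import Data.List.Membership.Propositional.Properties
  using (∈-++⁺ˡ; ∈-++⁺ʳ; ∈-map⁺; ∈-cartesianProduct⁺; ∈-filter⁺; ∈-filter⁻)
import Data.List.Properties as List
open import Data.List.Relation.Unary.All as All using (All; []; _∷_)
import Data.List.Relation.Unary.All.Properties as All
import Data.List.Relation.Unary.Any as Any
open import Data.Nat.Base as ℕ using (ℕ; zero; suc; z≤n; s≤s)
import Data.Nat.Properties as ℕ
open import Data.Nat.Solver renaming (module +-*-Solver to ℕ-Solver)
open import Data.Product.Base using (Σ; ∃-syntax; _×_; _,_; proj₁; proj₂)
open import Data.Rational.Base
  using (ℚ; mkℚ; 0ℚ; 1ℚ; ½; _/_; 1/_; _+_; _*_; _-_; -_; _≤_; _<_; ∣_∣; toℚᵘ; positive; nonNegative)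
import Data.Rational.Properties as ℚ
open import Data.Rational.Solver using (module +-*-Solver)
import Data.Rational.Unnormalised.Base as ℚᵘ
import Data.Rational.Unnormalised.Properties as ℚᵘ
open import Data.Sum.Base using (_⊎_; inj₁; inj₂)
open import Data.Vec.Base using (Vec; []; _∷_; here; there; _++_; splitAt)
open import Data.Vec.Properties using (zipWith-++)
open import Function.Base using (_∘_)
open import Relation.Binary.Bundles using (DecTotalOrder)
open import Relation.Binary.PropositionalEquality
  using (_≡_; _≢_; refl; sym; trans; cong; cong₂; subst; subst₂; module ≡-Reasoning)
open import Relation.Nullary using (¬_; Dec; yes; no)
open import Relation.Nullary.Decidable using (does; ¬?; _×-dec_; dec-true; dec-false)

open import Algebra.Properties.CommutativeMonoid.Sum ℕ.+-0-commutativeMonoid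
  using (sum; sum-cong-≗; ∑-distrib-+)
open import Algebra.Properties.CommutativeSemigroup ℕ.+-commutativeSemigroup using (interchange)
open import Algebra.Properties.Monoid.Mult ℚ.+-0-monoid using (×-homo-+) renaming (_×_ to _·_)
open import Algebra.Properties.Semiring.Exp (CommutativeRing.semiring ℚ.+-*-commutativeRing)
  using (_^_; ^-homo-*)
open import Data.List.Extrema (DecTotalOrder.totalOrder ℚ.≤-decTotalOrder)
  using (argmax; argmax-all; f[xs]≤f[argmax])
open +-*-Solver using (solve; _:=_; _:+_; _:*_; _:-_; :-_; con)
open ℕ-Solver using ()
  renaming (solve to ℕ-solve; _:+_ to _⊕_; _:*_ to _⊗_; _:=_ to _⊜_; con to ℕ-con)

-- Rational arithmetic and the Archimedean property.

ι : ℕ → ℚ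
ι n = n · 1ℚ

ι-+ : ∀ m n → ι (m ℕ.+ n) ≡ ι m + ι n
ι-+ = ×-homo-+ 1ℚ

≤-offset : ∀ {p q} d → 0ℚ ≤ d → q ≡ p + d → p ≤ q
≤-offset {p} {q} d 0≤d q≡p+d = begin
  p       ≡⟨ sym (ℚ.+-identityʳ p) ⟩
  p + 0ℚ  ≤⟨ ℚ.+-monoʳ-≤ p 0≤d ⟩
  p + d   ≡⟨ sym q≡p+d ⟩
  q       ∎
  where open ℚ.≤-Reasoning

≤⇒0≤- : ∀ {p q} → p ≤ q → 0ℚ ≤ q - p
≤⇒0≤- {p} {q} p≤q = subst (_≤ q - p) (ℚ.+-inverseʳ p) (ℚ.+-monoˡ-≤ (- p) p≤q)

0≤-⇒≤ : ∀ {p q} → 0ℚ ≤ q - p → p ≤ q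
0≤-⇒≤ {p} {q} h = ≤-offset (q - p) h (solve 2 (λ p q → q := p :+ (q :- p)) refl p q)

0≤+ : ∀ {p q} → 0ℚ ≤ p → 0ℚ ≤ q → 0ℚ ≤ p + q
0≤+ = ℚ.+-mono-≤

0≤* : ∀ {p q} → 0ℚ ≤ p → 0ℚ ≤ q → 0ℚ ≤ p * q
0≤* {p} {q} 0≤p 0≤q =
  subst (_≤ p * q) (ℚ.*-zeroʳ p) (ℚ.*-monoˡ-≤-nonNeg p {{nonNegative 0≤p}} 0≤q)

*-monoˡ : ∀ {p q} r → 0ℚ ≤ r → p ≤ q → r * p ≤ r * q
*-monoˡ r 0≤r = ℚ.*-monoˡ-≤-nonNeg r {{nonNegative 0≤r}}

*-monoʳ : ∀ {p q} r → 0ℚ ≤ r → p ≤ q → p * r ≤ q * r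
*-monoʳ r 0≤r = ℚ.*-monoʳ-≤-nonNeg r {{nonNegative 0≤r}}

0≤1 : 0ℚ ≤ 1ℚ
0≤1 = ℚ.<⇒≤ (ℚ.positive⁻¹ 1ℚ)

0≤½ : 0ℚ ≤ ½
0≤½ = ℚ.<⇒≤ (ℚ.positive⁻¹ ½)

0≤ι : ∀ n → 0ℚ ≤ ι n
0≤ι zero    = ℚ.≤-refl
0≤ι (suc n) = 0≤+ 0≤1 (0≤ι n)

ι-mono : ∀ {m n} → m ℕ.≤ n → ι m ≤ ι n
ι-mono {n = n} z≤n = 0≤ι n
ι-mono (s≤s m≤n)   = ℚ.+-monoʳ-≤ 1ℚ (ι-mono m≤n)

toℚᵘ-ι : ∀ n → toℚᵘ (ι n) ℚᵘ.≃ ℚᵘ.mkℚᵘ (+ n) 0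
toℚᵘ-ι zero    = ℚᵘ.≃-refl
toℚᵘ-ι (suc n) = begin
  toℚᵘ (1ℚ + ι n)                       ≈⟨ ℚ.toℚᵘ-homo-+ 1ℚ (ι n) ⟩
  toℚᵘ 1ℚ ℚᵘ.+ toℚᵘ (ι n)               ≈⟨ ℚᵘ.+-congʳ (toℚᵘ 1ℚ) (toℚᵘ-ι n) ⟩
  ℚᵘ.mkℚᵘ (+ 1) 0 ℚᵘ.+ ℚᵘ.mkℚᵘ (+ n) 0  ≈⟨ ℚᵘ.*≡* (cong (λ z → (+ 1 ℤ.+ z) ℤ.* + 1) (ℤ.*-identityʳ (+ n))) ⟩
  ℚᵘ.mkℚᵘ (+ suc n) 0                   ∎
  where open ℚᵘ.≃-Reasoning

ι-inverse : ∀ n → ι (suc n) * (+ 1 / suc n) ≡ 1ℚ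
ι-inverse n = ℚ.toℚᵘ-injective (begin
  toℚᵘ (ι (suc n) * (+ 1 / suc n))           ≈⟨ ℚ.toℚᵘ-homo-* (ι (suc n)) (+ 1 / suc n) ⟩
  toℚᵘ (ι (suc n)) ℚᵘ.* toℚᵘ (+ 1 / suc n)   ≈⟨ ℚᵘ.*-cong (toℚᵘ-ι (suc n)) (ℚ.toℚᵘ-fromℚᵘ (ℚᵘ.mkℚᵘ (+ 1) n)) ⟩
  ℚᵘ.mkℚᵘ (+ suc n) 0 ℚᵘ.* ℚᵘ.mkℚᵘ (+ 1) n   ≈⟨ ℚᵘ.*≡* num≡den ⟩
  ℚᵘ.1ℚᵘ                                     ∎)
  where
  open ℚᵘ.≃-Reasoning
  num≡den : + suc n ℤ.* + 1 ℤ.* + 1 ≡ + 1 ℤ.* + (1 ℕ.* suc n)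
  num≡den = trans (ℤ.*-identityʳ (+ suc n ℤ.* + 1))
    (trans (ℤ.*-identityʳ (+ suc n))
      (sym (trans (ℤ.*-identityˡ (+ (1 ℕ.* suc n))) (cong +_ (ℕ.*-identityˡ (suc n))))))

0≤1/ : ∀ n → 0ℚ ≤ + 1 / suc n
0≤1/ n = ℚ.nonNegative⁻¹ (+ 1 / suc n) {{ℚ.normalize-nonNeg 1 (suc n)}}

≤-ι : ∀ p → ∃[ n ] p ≤ ι n
≤-ι p@(mkℚ i d _) = ℤ.∣ i ∣ , ℚ.toℚᵘ-cancel-≤ (begin
  ℚᵘ.mkℚᵘ i d               ≤⟨ ℚᵘ.*≤* (bound i) ⟩
  ℚᵘ.mkℚᵘ (+ ℤ.∣ i ∣) 0     ≃⟨ ℚᵘ.≃-sym (toℚᵘ-ι ℤ.∣ i ∣) ⟩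
  toℚᵘ (ι ℤ.∣ i ∣)          ∎)
  where
  open ℚᵘ.≤-Reasoning
  bound : ∀ i → i ℤ.* + 1 ℤ.≤ + ℤ.∣ i ∣ ℤ.* + suc d
  bound (+ n)      = ℤ.*-monoˡ-≤-nonNeg (+ n) (ℤ.+≤+ (s≤s z≤n))
  bound ℤ.-[1+ n ] = ℤ.-≤+

archimedean : ∀ p {q} → 0ℚ < q → ∃[ n ] (∀ m → n ℕ.≤ m → p ≤ q * ι m)
archimedean p {q} 0<q = n , λ m n≤m → begin
  p              ≡⟨ sym (ℚ.*-identityˡ p) ⟩
  1ℚ * p         ≡⟨ cong (_* p) (sym (ℚ.*-inverseʳ q)) ⟩
  q * 1/q * p    ≡⟨ solve 3 (λ a b c → a :* b :* c := a :* (c :* b)) refl q 1/q p ⟩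
  q * (p * 1/q)  ≤⟨ *-monoˡ q (ℚ.<⇒≤ 0<q) (ℚ.≤-trans p/q≤n (ι-mono n≤m)) ⟩
  q * ι m        ∎
  where
  open ℚ.≤-Reasoning
  instance _ = ℚ.pos⇒nonZero q {{positive 0<q}}
  1/q = 1/ q
  n = proj₁ (≤-ι (p * 1/q))
  p/q≤n = proj₂ (≤-ι (p * 1/q))

-- Lower and upper bounds for powers of `1 - κ`.

module Powers (κ : ℚ) (0≤κ : 0ℚ ≤ κ) (κ≤1 : κ ≤ 1ℚ) where

  q : ℚ
  q = 1ℚ - κ

  0≤q : 0ℚ ≤ q
  0≤q = ≤⇒0≤- κ≤1

  0≤q^ : ∀ n → 0ℚ ≤ q ^ n
  0≤q^ zero    = 0≤1
  0≤q^ (suc n) = 0≤* 0≤q (0≤q^ n)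

  q^-suc≤ : ∀ n → q ^ suc n ≤ q ^ n
  q^-suc≤ n = ≤-offset (κ * q ^ n) (0≤* 0≤κ (0≤q^ n))
    (solve 2 (λ κ Q → Q := (con 1ℚ :- κ) :* Q :+ κ :* Q) refl κ (q ^ n))

  q^≤1 : ∀ n → q ^ n ≤ 1ℚ
  q^≤1 zero    = ℚ.≤-refl
  q^≤1 (suc n) = ℚ.≤-trans (q^-suc≤ n) (q^≤1 n)

  q^-antitone : ∀ {m n} → m ℕ.≤ n → q ^ n ≤ q ^ m
  q^-antitone {n = n} z≤n = q^≤1 n
  q^-antitone (s≤s m≤n)   = *-monoˡ q 0≤q (q^-antitone m≤n)

  -- In the inductive step, multiplying by `q ≥ 0` leaves the surplus `nκ²`.
  bernoulli : ∀ n → 1ℚ - ι n * κ ≤ q ^ n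
  bernoulli zero    = ℚ.≤-reflexive (solve 1 (λ κ → con 1ℚ :- con 0ℚ :* κ := con 1ℚ) refl κ)
  bernoulli (suc n) = 0≤-⇒≤ (subst (0ℚ ≤_)
    (solve 3 (λ κ N Q → (con 1ℚ :- κ) :* (Q :- (con 1ℚ :- N :* κ)) :+ N :* (κ :* κ)
                        := (con 1ℚ :- κ) :* Q :- (con 1ℚ :- (con 1ℚ :+ N) :* κ)) refl κ (ι n) (q ^ n))
    (0≤+ (0≤* 0≤q (≤⇒0≤- (bernoulli n))) (0≤* (0≤ι n) (0≤* 0≤κ 0≤κ))))

  -- The source of the constant ½ in the supermodularity ratio. In the step, `(1 - κ)(1 - nκ/2)`
  -- stays below the claimed bound by `κ(1 - nκ)/2`, which is nonnegative while `nκ ≤ 1`.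
  q^-upper : ∀ n → ι n * κ ≤ 1ℚ → q ^ n ≤ 1ℚ - ½ * (ι n * κ)
  q^-upper zero    _    = ℚ.≤-reflexive (solve 1 (λ κ → con 1ℚ := con 1ℚ :- con ½ :* (con 0ℚ :* κ)) refl κ)
  q^-upper (suc n) nκ≤1 = 0≤-⇒≤ (subst (0ℚ ≤_)
    (solve 3 (λ κ N Q → (con 1ℚ :- κ) :* (con 1ℚ :- con ½ :* (N :* κ) :- Q)
                          :+ con ½ :* (κ :* (con 1ℚ :- N :* κ))
                        := con 1ℚ :- con ½ :* ((con 1ℚ :+ N) :* κ) :- (con 1ℚ :- κ) :* Q) refl κ (ι n) (q ^ n))
    (0≤+ (0≤* 0≤q (≤⇒0≤- (q^-upper n n≤))) (0≤* 0≤½ (0≤* 0≤κ (≤⇒0≤- n≤)))))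
    where
    n≤ : ι n * κ ≤ 1ℚ
    n≤ = ℚ.≤-trans (*-monoʳ κ 0≤κ (ι-mono (ℕ.n≤1+n n))) nκ≤1

1/suc≤1 : ∀ n → + 1 / suc n ≤ 1ℚ
1/suc≤1 n = ≤-offset (ι n * u) (0≤* (0≤ι n) (0≤1/ n))
  (trans (sym (ι-inverse n)) (solve 2 (λ N u → (con 1ℚ :+ N) :* u := u :+ N :* u) refl (ι n) u))
  where u = + 1 / suc n

-- Comparison of `(1 - κ)ᵏ` with `e⁻¹`.

p≤∣p∣ : ∀ p → p ≤ ∣ p ∣
p≤∣p∣ p with ℚ.≤-total 0ℚ p
... | inj₁ 0≤p = ℚ.≤-reflexive (sym (ℚ.0≤p⇒∣p∣≡p 0≤p))
... | inj₂ p≤0 = ℚ.≤-trans p≤0 (ℚ.0≤∣p∣ p)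

∣*∣≤ : ∀ {p q B} → ∣ p ∣ ≤ B → ∣ q ∣ ≤ 1ℚ → ∣ p * q ∣ ≤ B
∣*∣≤ {p} {q} {B} p≤B q≤1 = begin
  ∣ p * q ∣      ≡⟨ ℚ.∣p*q∣≡∣p∣*∣q∣ p q ⟩
  ∣ p ∣ * ∣ q ∣  ≤⟨ *-monoˡ ∣ p ∣ (ℚ.0≤∣p∣ p) q≤1 ⟩
  ∣ p ∣ * 1ℚ     ≡⟨ ℚ.*-identityʳ ∣ p ∣ ⟩
  ∣ p ∣          ≤⟨ p≤B ⟩
  B              ∎
  where open ℚ.≤-Reasoning

∣nonNeg∣≤ : ∀ {p B} → 0ℚ ≤ p → p ≤ B → ∣ p ∣ ≤ B
∣nonNeg∣≤ {B = B} 0≤p p≤B = subst (_≤ B) (sym (ℚ.0≤p⇒∣p∣≡p 0≤p)) p≤B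

-- `termError i` is the binomial coefficient C(i,2) and `sumError m` is C(m,3). Times `κ`, they
-- bound the errors of single terms and of partial sums.
termError : ℕ → ℚ
termError zero    = 0ℚ
termError (suc i) = termError i + ι i

sumError : ℕ → ℚ
sumError zero    = 0ℚ
sumError (suc m) = sumError m + termError m

-- `double (suc j)` unfolds to two successors, one for each half of the alternation in
-- `below-double`.
double : ℕ → ℕ
double zero    = 0
double (suc n) = suc (suc (double n))

n≤double : ∀ n → n ℕ.≤ double n
n≤double zero    = z≤n
n≤double (suc n) = s≤s (ℕ.m≤n⇒m≤1+n (n≤double n))

-- Truncations of the binomial expansion of (1 - κ)ˣ lie alternately below and
-- above it (Bonferroni), and for x = 1/κ they approach those of e⁻¹.

module Binomial (κ : ℚ) (0≤κ : 0ℚ ≤ κ) (κ≤1 : κ ≤ 1ℚ) where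

  open Powers κ 0≤κ κ≤1

  -- (-κ)ⁱ C(x,i)
  term : ℕ → ℚ → ℚ
  term zero    x = 1ℚ
  term (suc i) x = - (term i x * ((x - ι i) * κ) * (+ 1 / suc i))

  partialSum : ℕ → ℚ → ℚ
  partialSum zero    x = 0ℚ
  partialSum (suc m) x = partialSum m x + term m x

  -- The identity (x+1-i) C(x+1,i) = (x+1) C(x,i), multiplied by `(-κ)ⁱ`. It trades `1 + x` for `x`
  -- without a division.
  absorption : ∀ i x → term i (1ℚ + x) * (1ℚ + x - ι i) ≡ term i x * (1ℚ + x)
  absorption zero    x = solve 1 (λ x → con 1ℚ :* (con 1ℚ :+ x :- con 0ℚ) := con 1ℚ :* (con 1ℚ :+ x)) refl x
  absorption (suc i) x = begin
    - (t′ * ((1ℚ + x - ι i) * κ) * u) * (1ℚ + x - (1ℚ + ι i))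
      ≡⟨ solve 5 (λ t x N κ u → :- (t :* ((con 1ℚ :+ x :- N) :* κ) :* u) :* (con 1ℚ :+ x :- (con 1ℚ :+ N))
                             := :- ((t :* (con 1ℚ :+ x :- N)) :* ((x :- N) :* κ) :* u)) refl t′ x (ι i) κ u ⟩
    - ((t′ * (1ℚ + x - ι i)) * ((x - ι i) * κ) * u)
      ≡⟨ cong (λ z → - (z * ((x - ι i) * κ) * u)) (absorption i x) ⟩
    - ((t * (1ℚ + x)) * ((x - ι i) * κ) * u)
      ≡⟨ solve 5 (λ t x N κ u → :- ((t :* (con 1ℚ :+ x)) :* ((x :- N) :* κ) :* u)
                             := :- (t :* ((x :- N) :* κ) :* u) :* (con 1ℚ :+ x)) refl t x (ι i) κ u ⟩
    - (t * ((x - ι i) * κ) * u) * (1ℚ + x) ∎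
    where
    open ≡-Reasoning
    t = term i x
    t′ = term i (1ℚ + x)
    u = + 1 / suc i

  -- Pascal's rule C(x+1,i+1) = C(x,i+1) + C(x,i), multiplied by `(-κ)ⁱ⁺¹`.
  pascal : ∀ i x → term (suc i) (1ℚ + x) ≡ term (suc i) x - κ * term i x
  pascal i x = begin
    - (t′ * ((1ℚ + x - ι i) * κ) * u)
      ≡⟨ solve 4 (λ t y κ u → :- (t :* (y :* κ) :* u) := :- ((t :* y) :* κ :* u)) refl t′ (1ℚ + x - ι i) κ u ⟩
    - ((t′ * (1ℚ + x - ι i)) * κ * u)
      ≡⟨ cong (λ z → - (z * κ * u)) (absorption i x) ⟩
    - ((t * (1ℚ + x)) * κ * u)
      -- Split `1 + x` as `(x - i) + (1 + i)`; the second part will cancel against `u`.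
      ≡⟨ solve 5 (λ t x N κ u → :- ((t :* (con 1ℚ :+ x)) :* κ :* u)
                             := :- (t :* ((x :- N) :* κ) :* u) :- κ :* t :* ((con 1ℚ :+ N) :* u)) refl
           t x (ι i) κ u ⟩
    - (t * ((x - ι i) * κ) * u) - κ * t * (ι (suc i) * u)
      ≡⟨ cong (λ z → - (t * ((x - ι i) * κ) * u) - κ * t * z) (ι-inverse i) ⟩
    - (t * ((x - ι i) * κ) * u) - κ * t * 1ℚ
      ≡⟨ cong (λ z → - (t * ((x - ι i) * κ) * u) - z) (ℚ.*-identityʳ (κ * t)) ⟩
    - (t * ((x - ι i) * κ) * u) - κ * t ∎
    where
    open ≡-Reasoning
    t = term i x
    t′ = term i (1ℚ + x)
    u = + 1 / suc i

  -- Pascal's rule, summed. It imitates `q ^ suc n = q ^ n - κ * q ^ n`, but the subtracted sum is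
  -- one term shorter; this shift makes lower and upper bounds alternate.
  partialSum-step : ∀ m x → partialSum (suc m) (1ℚ + x) ≡ partialSum (suc m) x - κ * partialSum m x
  partialSum-step zero    x = solve 1 (λ κ → con 0ℚ :+ con 1ℚ := con 0ℚ :+ con 1ℚ :- κ :* con 0ℚ) refl κ
  partialSum-step (suc m) x = begin
    partialSum (suc m) (1ℚ + x) + term (suc m) (1ℚ + x)
      ≡⟨ cong₂ _+_ (partialSum-step m x) (pascal m x) ⟩
    (partialSum (suc m) x - κ * partialSum m x) + (term (suc m) x - κ * term m x)
      ≡⟨ solve 5 (λ κ a b c d → (a :- κ :* b) :+ (c :- κ :* d) := a :+ c :- κ :* (b :+ d)) refl
           κ (partialSum (suc m) x) (partialSum m x) (term (suc m) x) (term m x) ⟩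
    partialSum (2 ℕ.+ m) x - κ * partialSum (suc m) x ∎
    where open ≡-Reasoning

  term-0 : ∀ i → term (suc i) 0ℚ ≡ 0ℚ
  term-0 zero    = solve 2 (λ κ u → :- (con 1ℚ :* ((con 0ℚ :- con 0ℚ) :* κ) :* u) := con 0ℚ) refl κ (+ 1 / 1)
  term-0 (suc i) = trans (cong (λ t → - (t * ((0ℚ - ι (suc i)) * κ) * (+ 1 / suc (suc i)))) (term-0 i))
    (solve 2 (λ y u → :- (con 0ℚ :* y :* u) := con 0ℚ) refl ((0ℚ - ι (suc i)) * κ) (+ 1 / suc (suc i)))

  partialSum-0 : ∀ m → partialSum (suc m) 0ℚ ≡ 1ℚ
  partialSum-0 zero    = refl
  partialSum-0 (suc m) = cong₂ _+_ (partialSum-0 m) (term-0 m)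

  Below Above : ℕ → Set
  Below m = ∀ n → partialSum m (ι n) ≤ q ^ n
  Above m = ∀ n → q ^ n ≤ partialSum m (ι n)

  -- Induction on the exponent. By `partialSum-step`, the new error is the old error of the longer
  -- sum plus `κ` times that of the shorter one, the latter with its sign reversed.
  below⇒above : ∀ m → Below m → Above (suc m)
  below⇒above m below zero    = ℚ.≤-reflexive (sym (partialSum-0 m))
  below⇒above m below (suc n) = subst (q ^ suc n ≤_) (sym (partialSum-step m (ι n)))
    (0≤-⇒≤ (subst (0ℚ ≤_)
      (solve 4 (λ κ Q a b → (a :- Q) :+ κ :* (Q :- b) := (a :- κ :* b) :- (con 1ℚ :- κ) :* Q) refl
        κ (q ^ n) (partialSum (suc m) (ι n)) (partialSum m (ι n)))
      (0≤+ (≤⇒0≤- (below⇒above m below n)) (0≤* 0≤κ (≤⇒0≤- (below n))))))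

  above⇒below : ∀ m → Above m → Below (suc m)
  above⇒below m above zero    = ℚ.≤-reflexive (partialSum-0 m)
  above⇒below m above (suc n) = subst (_≤ q ^ suc n) (sym (partialSum-step m (ι n)))
    (0≤-⇒≤ (subst (0ℚ ≤_)
      (solve 4 (λ κ Q a b → (Q :- a) :+ κ :* (b :- Q) := (con 1ℚ :- κ) :* Q :- (a :- κ :* b)) refl
        κ (q ^ n) (partialSum (suc m) (ι n)) (partialSum m (ι n)))
      (0≤+ (≤⇒0≤- (above⇒below m above n)) (0≤* 0≤κ (≤⇒0≤- (above n))))))

  -- The alternation starts from the empty sum, which lies below every power of `q ≥ 0`.
  below-double : ∀ j → Below (double j)
  below-double zero    n = 0≤q^ n
  below-double (suc j)   = above⇒below (suc (double j)) (below⇒above (double j) (below-double j))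

  module _ {k : ℕ} (kκ≡1 : ι k * κ ≡ 1ℚ) where

    -- As `kκ = 1`, the factor `(k - i)κ` is `1 - iκ`, where `expTerm` has 1. For `i ≤ k` it lies in
    -- [0,1], so each step adds at most `iκ` to the error. The bound on the term itself is carried
    -- along because this estimate uses it.
    term-bounds : ∀ i → i ℕ.≤ k →
      ∣ term i (ι k) ∣ ≤ 1ℚ × ∣ expTerm i - term i (ι k) ∣ ≤ termError i * κ
    term-bounds zero    _   = ℚ.≤-refl , ℚ.≤-reflexive (sym (ℚ.*-zeroˡ κ))
    term-bounds (suc i) i<k = ∣t′∣≤1 , (begin
      ∣ - (e * u) - - (t * ((ι k - ι i) * κ) * u) ∣
        ≡⟨ cong (λ z → ∣ - (e * u) - - (t * z * u) ∣) w≡ ⟩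
      ∣ - (e * u) - - (t * (1ℚ - x) * u) ∣
        ≡⟨ cong ∣_∣ (solve 4 (λ e t x u → :- (e :* u) :- :- (t :* (con 1ℚ :- x) :* u)
                                       := :- (((e :- t) :+ t :* x) :* u)) refl e t x u) ⟩
      ∣ - (((e - t) + t * x) * u) ∣
        ≡⟨ ℚ.∣-p∣≡∣p∣ (((e - t) + t * x) * u) ⟩
      ∣ ((e - t) + t * x) * u ∣
        ≤⟨ ∣*∣≤ {(e - t) + t * x} {u}
             (ℚ.≤-trans (ℚ.∣p+q∣≤∣p∣+∣q∣ (e - t) (t * x)) (ℚ.+-mono-≤ (proj₂ ih) ∣tx∣≤x)) ∣u∣≤1 ⟩
      termError i * κ + x
        ≡⟨ sym (ℚ.*-distribʳ-+ κ (termError i) (ι i)) ⟩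
      termError (suc i) * κ ∎)
      where
      open ℚ.≤-Reasoning
      i≤k = ℕ.<⇒≤ i<k
      ih = term-bounds i i≤k
      t = term i (ι k)
      e = expTerm i
      u = + 1 / suc i
      x = ι i * κ
      w≡ : (ι k - ι i) * κ ≡ 1ℚ - x
      w≡ = trans (solve 3 (λ K N κ → (K :- N) :* κ := K :* κ :- N :* κ) refl (ι k) (ι i) κ) (cong (_- x) kκ≡1)
      0≤x : 0ℚ ≤ x
      0≤x = 0≤* (0≤ι i) 0≤κ
      0≤w : 0ℚ ≤ (ι k - ι i) * κ
      0≤w = 0≤* (≤⇒0≤- (ι-mono i≤k)) 0≤κ
      w≤1 : (ι k - ι i) * κ ≤ 1ℚ
      w≤1 = subst (_≤ 1ℚ) (sym w≡) (≤-offset x 0≤x (solve 1 (λ x → con 1ℚ := con 1ℚ :- x :+ x) refl x))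
      ∣u∣≤1 : ∣ u ∣ ≤ 1ℚ
      ∣u∣≤1 = ∣nonNeg∣≤ (0≤1/ i) (1/suc≤1 i)
      ∣tx∣≤x : ∣ t * x ∣ ≤ x
      ∣tx∣≤x = subst (λ z → ∣ z ∣ ≤ x) (ℚ.*-comm x t) (∣*∣≤ {x} {t} (∣nonNeg∣≤ 0≤x ℚ.≤-refl) (proj₁ ih))
      ∣t′∣≤1 : ∣ - (t * ((ι k - ι i) * κ) * u) ∣ ≤ 1ℚ
      ∣t′∣≤1 = subst (_≤ 1ℚ) (sym (ℚ.∣-p∣≡∣p∣ (t * ((ι k - ι i) * κ) * u)))
        (∣*∣≤ {t * ((ι k - ι i) * κ)} {u} (∣*∣≤ {t} {(ι k - ι i) * κ} (proj₁ ih) (∣nonNeg∣≤ 0≤w w≤1)) ∣u∣≤1)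

    expPartialSum≤ : ∀ m → m ℕ.≤ k → expPartialSum m ≤ partialSum m (ι k) + sumError m * κ
    expPartialSum≤ zero    _   = ℚ.≤-reflexive (sym (trans (ℚ.+-identityˡ (0ℚ * κ)) (ℚ.*-zeroˡ κ)))
    expPartialSum≤ (suc m) m<k = begin
      expPartialSum m + e
        ≤⟨ ℚ.+-mono-≤ (expPartialSum≤ m m≤k) e≤ ⟩
      (partialSum m (ι k) + sumError m * κ) + (t + termError m * κ)
        ≡⟨ solve 5 (λ S s t e κ → (S :+ s :* κ) :+ (t :+ e :* κ) := S :+ t :+ (s :+ e) :* κ) refl
             (partialSum m (ι k)) (sumError m) t (termError m) κ ⟩
      partialSum (suc m) (ι k) + sumError (suc m) * κ ∎
      where
      open ℚ.≤-Reasoning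
      m≤k = ℕ.<⇒≤ m<k
      t = term m (ι k)
      e = expTerm m
      e≤ : e ≤ t + termError m * κ
      e≤ = begin
        e                    ≡⟨ solve 2 (λ e t → e := t :+ (e :- t)) refl e t ⟩
        t + (e - t)          ≤⟨ ℚ.+-monoʳ-≤ t (ℚ.≤-trans (p≤∣p∣ (e - t)) (proj₂ (term-bounds m m≤k))) ⟩
        t + termError m * κ  ∎

    -- The limit argument has to show that `q ^ k` is not far below `e⁻¹`, and truncations of even
    -- length bound `q ^ k` from below.
    expPartialSum-double≤ : ∀ j → double j ℕ.≤ k → expPartialSum (double j) ≤ q ^ k + sumError (double j) * κ
    expPartialSum-double≤ j 2j≤k =
      ℚ.≤-trans (expPartialSum≤ (double j) 2j≤k) (ℚ.+-monoˡ-≤ (sumError (double j) * κ) (below-double j k))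

-- Cardinalities relative to a fixed subset

∥∪∩∥ : ∀ {d} (L T O : Subset d) → Empty (L ∩ T) → ∥ (L ∪ T) ∩ O ∥ ≡ ∥ L ∩ O ∥ ℕ.+ ∥ T ∩ O ∥
∥∪∩∥ [] [] [] _ = refl
∥∪∩∥ (inside ∷ L) (inside ∷ T) (_ ∷ O) L∩T=∅ = ⊥-elim (L∩T=∅ (zero , here))
∥∪∩∥ (inside ∷ L) (outside ∷ T) (inside ∷ O) L∩T=∅ = cong suc (∥∪∩∥ L T O (drop-∷-Empty L∩T=∅))
∥∪∩∥ (outside ∷ L) (inside ∷ T) (inside ∷ O) L∩T=∅ =
  trans (cong suc (∥∪∩∥ L T O (drop-∷-Empty L∩T=∅))) (sym (ℕ.+-suc ∥ L ∩ O ∥ ∥ T ∩ O ∥))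
∥∪∩∥ (outside ∷ L) (outside ∷ T) (inside ∷ O) L∩T=∅ = ∥∪∩∥ L T O (drop-∷-Empty L∩T=∅)
∥∪∩∥ (inside ∷ L) (outside ∷ T) (outside ∷ O) L∩T=∅ = ∥∪∩∥ L T O (drop-∷-Empty L∩T=∅)
∥∪∩∥ (outside ∷ L) (inside ∷ T) (outside ∷ O) L∩T=∅ = ∥∪∩∥ L T O (drop-∷-Empty L∩T=∅)
∥∪∩∥ (outside ∷ L) (outside ∷ T) (outside ∷ O) L∩T=∅ = ∥∪∩∥ L T O (drop-∷-Empty L∩T=∅)

∥∩∥+∥∩∁∥ : ∀ {d} (S O : Subset d) → ∥ S ∩ O ∥ ℕ.+ ∥ S ∩ ∁ O ∥ ≡ ∥ S ∥
∥∩∥+∥∩∁∥ [] [] = refl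
∥∩∥+∥∩∁∥ (outside ∷ S) (_ ∷ O) = ∥∩∥+∥∩∁∥ S O
∥∩∥+∥∩∁∥ (inside ∷ S) (inside ∷ O) = cong suc (∥∩∥+∥∩∁∥ S O)
∥∩∥+∥∩∁∥ (inside ∷ S) (outside ∷ O) = trans (ℕ.+-suc ∥ S ∩ O ∥ ∥ S ∩ ∁ O ∥) (cong suc (∥∩∥+∥∩∁∥ S O))

∥⊥∩∥ : ∀ {d} (O : Subset d) → ∥ ⊥ ∩ O ∥ ≡ 0
∥⊥∩∥ {d} O = trans (cong ∥_∥ (∩-zeroˡ O)) (∣⊥∣≡0 d)

∥⁅⁆∩∥-∈ : ∀ {d} {j : Fin d} {O} → j ∈ O → ∥ ⁅ j ⁆ ∩ O ∥ ≡ 1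
∥⁅⁆∩∥-∈ {O = _ ∷ O} here        = cong suc (∥⊥∩∥ O)
∥⁅⁆∩∥-∈             (there j∈O) = ∥⁅⁆∩∥-∈ j∈O

∥⁅⁆∩∥-∉ : ∀ {d} {j : Fin d} {O} → j ∉ O → ∥ ⁅ j ⁆ ∩ O ∥ ≡ 0
∥⁅⁆∩∥-∉ {j = zero}  {inside  ∷ O} j∉O = ⊥-elim (j∉O here)
∥⁅⁆∩∥-∉ {j = zero}  {outside ∷ O} j∉O = ∥⊥∩∥ O
∥⁅⁆∩∥-∉ {j = suc j} {_ ∷ O}       j∉O = ∥⁅⁆∩∥-∉ (j∉O ∘ there)

∥∪∥ : ∀ {d} (L T : Subset d) → Empty (L ∩ T) → ∥ L ∪ T ∥ ≡ ∥ L ∥ ℕ.+ ∥ T ∥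
∥∪∥ [] [] _ = refl
∥∪∥ (inside ∷ L) (inside ∷ T) L∩T=∅ = ⊥-elim (L∩T=∅ (zero , here))
∥∪∥ (inside ∷ L) (outside ∷ T) L∩T=∅ = cong suc (∥∪∥ L T (drop-∷-Empty L∩T=∅))
∥∪∥ (outside ∷ L) (inside ∷ T) L∩T=∅ =
  trans (cong suc (∥∪∥ L T (drop-∷-Empty L∩T=∅))) (sym (ℕ.+-suc ∥ L ∥ ∥ T ∥))
∥∪∥ (outside ∷ L) (outside ∷ T) L∩T=∅ = ∥∪∥ L T (drop-∷-Empty L∩T=∅)

Empty-∩⁅⁆ : ∀ {d} {L T : Subset d} {j} → Empty (L ∩ T) → j ∈ T → Empty (L ∩ ⁅ j ⁆)
Empty-∩⁅⁆ {L = L} {T} {j} L∩T=∅ j∈T (i , i∈) with x∈p∩q⁻ L ⁅ j ⁆ i∈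
... | i∈L , i∈⁅j⁆ with x∈⁅y⁆⇒x≡y j i∈⁅j⁆
... | refl = L∩T=∅ (j , x∈p∩q⁺ (i∈L , j∈T))

-- Sums over subsets

∑ℚ : ∀ {d} → Subset d → (Fin d → ℚ) → ℚ
∑ℚ {d} T h = foldr _+_ 0ℚ (map h (filter (_∈? T) (allFin d)))

seq-∑ : ∀ {d} (T : Subset d) g n → seq (∑[ T ] g) n ≡ ∑ℚ T (λ j → seq (g j) n)
seq-∑ {d} T g n = go (filter (_∈? T) (allFin d))
  where
  go : ∀ xs → seq (foldr _+ℝ_ 0ℝ (map g xs)) n ≡ foldr _+_ 0ℚ (map (λ j → seq (g j) n) xs)
  go []       = refl
  go (x ∷ xs) = cong (λ z → seq (g x) n + z) (go xs)

filter-∈?-suc : ∀ {d} s (T : Subset d) xs → filter (_∈? (s ∷ T)) (map suc xs) ≡ map suc (filter (_∈? T) xs)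
filter-∈?-suc s T [] = refl
filter-∈?-suc s T (x ∷ xs) with does (x ∈? T)
... | true  = cong (suc x ∷_) (filter-∈?-suc s T xs)
... | false = filter-∈?-suc s T xs

∑ℚ-tail : ∀ {d} s (T : Subset d) h →
  foldr _+_ 0ℚ (map h (filter (_∈? (s ∷ T)) (tabulate suc))) ≡ ∑ℚ T (h ∘ suc)
∑ℚ-tail s T h = cong (foldr _+_ 0ℚ) (begin
  map h (filter (_∈? (s ∷ T)) (tabulate suc))
    ≡⟨ cong (map h ∘ filter (_∈? (s ∷ T))) (sym (List.map-tabulate (λ i → i) suc)) ⟩
  map h (filter (_∈? (s ∷ T)) (map suc (allFin _)))
    ≡⟨ cong (map h) (filter-∈?-suc s T (allFin _)) ⟩
  map h (map suc (filter (_∈? T) (allFin _)))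
    ≡⟨ sym (List.map-∘ (filter (_∈? T) (allFin _))) ⟩
  map (h ∘ suc) (filter (_∈? T) (allFin _)) ∎)
  where open ≡-Reasoning

-- For `h` the gain of a single element, which depends only on whether the element lies in `O`.
∑ℚ-two-valued : ∀ {d} (T O : Subset d) h x y →
  (∀ j → j ∈ T → j ∈ O → h j ≡ x) → (∀ j → j ∈ T → j ∉ O → h j ≡ y) →
  ∑ℚ T h ≡ ι ∥ T ∩ O ∥ * x + ι ∥ T ∩ ∁ O ∥ * y
∑ℚ-two-valued [] [] h x y _ _ = solve 2 (λ x y → con 0ℚ := con 0ℚ :* x :+ con 0ℚ :* y) refl x y
∑ℚ-two-valued (outside ∷ T) (o ∷ O) h x y ∈O ∉O = trans (∑ℚ-tail outside T h)
  (∑ℚ-two-valued T O (h ∘ suc) x y (λ j j∈T j∈O → ∈O (suc j) (there j∈T) (there j∈O))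
    (λ j j∈T j∉O → ∉O (suc j) (there j∈T) λ { (there j∈O) → j∉O j∈O }))
∑ℚ-two-valued (inside ∷ T) (inside ∷ O) h x y ∈O ∉O = trans
  (cong₂ _+_ (∈O zero here here) (trans (∑ℚ-tail inside T h)
    (∑ℚ-two-valued T O (h ∘ suc) x y (λ j j∈T j∈O → ∈O (suc j) (there j∈T) (there j∈O))
      (λ j j∈T j∉O → ∉O (suc j) (there j∈T) λ { (there j∈O) → j∉O j∈O }))))
  (solve 4 (λ x y m n → x :+ (m :* x :+ n :* y) := (con 1ℚ :+ m) :* x :+ n :* y) refl
    x y (ι ∥ T ∩ O ∥) (ι ∥ T ∩ ∁ O ∥))
∑ℚ-two-valued (inside ∷ T) (outside ∷ O) h x y ∈O ∉O = trans
  (cong₂ _+_ (∉O zero here λ ()) (trans (∑ℚ-tail inside T h)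
    (∑ℚ-two-valued T O (h ∘ suc) x y (λ j j∈T j∈O → ∈O (suc j) (there j∈T) (there j∈O))
      (λ j j∈T j∉O → ∉O (suc j) (there j∈T) λ { (there j∈O) → j∉O j∈O }))))
  (solve 4 (λ x y m n → y :+ (m :* x :+ n :* y) := m :* x :+ (con 1ℚ :+ n) :* y) refl
    x y (ι ∥ T ∩ O ∥) (ι ∥ T ∩ ∁ O ∥))

-- Values as a function of the numbers a and c of elements inside and outside O

-- Of `s` new elements of `O`, `s₁` fill the places left among the first `r`, and `s₂` come after
-- them. The final disjunction says that there is nothing left to fill once the first `r` places
-- have been exceeded.
overflow : ∀ a r s → ∃[ s₁ ] ∃[ s₂ ] s₁ ℕ.+ s₂ ≡ s ×
  (a ℕ.+ s) ℕ.⊓ r ≡ a ℕ.⊓ r ℕ.+ s₁ × (a ℕ.+ s) ℕ.∸ r ≡ a ℕ.∸ r ℕ.+ s₂ ×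
  (s₁ ≡ 0 ⊎ a ℕ.∸ r ≡ 0)
overflow zero    r       s = s ℕ.⊓ r , s ℕ.∸ r ,
  trans (cong (ℕ._+ (s ℕ.∸ r)) (ℕ.⊓-comm s r)) (ℕ.m⊓n+n∸m≡n r s) , refl ,
  cong (ℕ._+ (s ℕ.∸ r)) (sym (ℕ.0∸n≡0 r)) , inj₂ (ℕ.0∸n≡0 r)
overflow (suc a) zero    s = 0 , s , refl , refl , refl , inj₁ refl
overflow (suc a) (suc r) s with overflow a r s
... | s₁ , s₂ , sum , min , excess , zero? = s₁ , s₂ , sum , cong suc min , excess , zero?

module Values (κ : ℚ) (0≤κ : 0ℚ ≤ κ) (κ≤1 : κ ≤ 1ℚ) (r k : ℕ) (kκ≡1 : ι k * κ ≡ 1ℚ) where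

  open Powers κ 0≤κ κ≤1

  remaining : ℕ → ℚ
  remaining a = 1ℚ - ι (a ℕ.∸ r) * κ

  discount : ℕ → ℕ → ℚ
  discount a c = q ^ (a ℕ.⊓ r ℕ.+ c)

  g : ℕ → ℕ → ℚ
  g a c = 1ℚ - remaining a * discount a c

  ικ≤1 : ∀ {n} → n ℕ.≤ k → ι n * κ ≤ 1ℚ
  ικ≤1 {n} n≤k = subst (ι n * κ ≤_) kκ≡1 (*-monoʳ κ 0≤κ (ι-mono n≤k))

  remaining-antitone : ∀ {a b} → a ℕ.≤ b → remaining b ≤ remaining a
  remaining-antitone a≤b =
    ℚ.+-monoʳ-≤ 1ℚ (ℚ.neg-antimono-≤ (*-monoʳ κ 0≤κ (ι-mono (ℕ.∸-monoˡ-≤ r a≤b))))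

  0≤remaining : ∀ {a} → a ℕ.≤ k → 0ℚ ≤ remaining a
  0≤remaining {a} a≤k = ≤⇒0≤- (ικ≤1 (ℕ.≤-trans (ℕ.m∸n≤m a r) a≤k))

  remaining≤1 : ∀ a → remaining a ≤ 1ℚ
  remaining≤1 a = ≤-offset (ι (a ℕ.∸ r) * κ) (0≤* (0≤ι (a ℕ.∸ r)) 0≤κ)
    (solve 1 (λ x → con 1ℚ := con 1ℚ :- x :+ x) refl (ι (a ℕ.∸ r) * κ))

  g≤1 : ∀ {a} c → a ℕ.≤ k → g a c ≤ 1ℚ
  g≤1 {a} c a≤k = ≤-offset (remaining a * discount a c) (0≤* (0≤remaining a≤k) (0≤q^ (a ℕ.⊓ r ℕ.+ c)))
    (solve 1 (λ x → con 1ℚ := con 1ℚ :- x :+ x) refl (remaining a * discount a c))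

  g-mono : ∀ {a b c d} → a ℕ.≤ b → b ℕ.≤ k → c ℕ.≤ d → g a c ≤ g b d
  g-mono {a} {b} {c} {d} a≤b b≤k c≤d = ℚ.+-monoʳ-≤ 1ℚ (ℚ.neg-antimono-≤ (begin
    remaining b * discount b d  ≤⟨ *-monoˡ (remaining b) (0≤remaining b≤k)
                                     (q^-antitone (ℕ.+-mono-≤ (ℕ.⊓-monoˡ-≤ r a≤b) c≤d)) ⟩
    remaining b * discount a c  ≤⟨ *-monoʳ (discount a c) (0≤q^ (a ℕ.⊓ r ℕ.+ c)) (remaining-antitone a≤b) ⟩
    remaining a * discount a c  ∎))
    where open ℚ.≤-Reasoning

  -- Up to `r` hits the value depends on `a + c` alone, hence on the size of the set and not on `O`.
  g-hidden : ∀ {a} c → a ℕ.≤ r → g a c ≡ 1ℚ - q ^ (a ℕ.+ c)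
  g-hidden {a} c a≤r rewrite ℕ.m≤n⇒m∸n≡0 a≤r | ℕ.m≤n⇒m⊓n≡m a≤r =
    solve 2 (λ κ Q → con 1ℚ :- (con 1ℚ :- con 0ℚ :* κ) :* Q := con 1ℚ :- Q) refl κ (q ^ (a ℕ.+ c))

  -- The gains of one more element of `O` and of one more element outside it, as `gain-inner` and
  -- `gain-outer` confirm.
  inner outer : ℕ → ℕ → ℚ
  inner a c = discount a c * κ
  outer a c = discount a c * (remaining a * κ)

  -- Of s further elements of O, s₁ count like elements outside O.
  record Step (a c s t : ℕ) : Set where
    field
      s₁ s₂          : ℕ
      s₁+s₂          : s₁ ℕ.+ s₂ ≡ s
      gain           : g (a ℕ.+ s) (c ℕ.+ t) - g a c
                       ≡ discount a c * (remaining a - (remaining a - ι s₂ * κ) * q ^ (s₁ ℕ.+ t))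
      remaining-step : remaining (a ℕ.+ s) ≡ remaining a - ι s₂ * κ
      untouched      : ι s₁ * (1ℚ - remaining a) ≡ 0ℚ

  step : ∀ a c s t → Step a c s t
  step a c s t with overflow a r s
  ... | s₁ , s₂ , s₁+s₂ , min , excess , zero? = record
    { s₁ = s₁ ; s₂ = s₂ ; s₁+s₂ = s₁+s₂
    ; gain = begin
        (1ℚ - remaining (a ℕ.+ s) * discount (a ℕ.+ s) (c ℕ.+ t)) - g a c
          ≡⟨ cong₂ (λ x y → (1ℚ - x * y) - g a c) rem disc ⟩
        (1ℚ - (remaining a - ι s₂ * κ) * (discount a c * q ^ (s₁ ℕ.+ t))) - g a c
          ≡⟨ solve 4 (λ P x D w → (con 1ℚ :- (P :- x) :* (D :* w)) :- (con 1ℚ :- P :* D)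
                                  := D :* (P :- (P :- x) :* w)) refl
               (remaining a) (ι s₂ * κ) (discount a c) (q ^ (s₁ ℕ.+ t)) ⟩
        discount a c * (remaining a - (remaining a - ι s₂ * κ) * q ^ (s₁ ℕ.+ t)) ∎
    ; remaining-step = rem
    ; untouched = lemma zero?
    }
    where
    open ≡-Reasoning
    rem : remaining (a ℕ.+ s) ≡ remaining a - ι s₂ * κ
    rem = trans (cong (λ n → 1ℚ - n * κ) (trans (cong ι excess) (ι-+ (a ℕ.∸ r) s₂)))
      (solve 3 (λ x y κ → con 1ℚ :- (x :+ y) :* κ := con 1ℚ :- x :* κ :- y :* κ) refl (ι (a ℕ.∸ r)) (ι s₂) κ)
    disc : discount (a ℕ.+ s) (c ℕ.+ t) ≡ discount a c * q ^ (s₁ ℕ.+ t)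
    disc = trans (cong (q ^_) (trans (cong (ℕ._+ (c ℕ.+ t)) min) (interchange (a ℕ.⊓ r) s₁ c t)))
      (^-homo-* q (a ℕ.⊓ r ℕ.+ c) (s₁ ℕ.+ t))
    -- Either nothing is filled or `remaining a` is still 1. As a vanishing product, this
    -- alternative can be inserted into ring identities.
    lemma : s₁ ≡ 0 ⊎ a ℕ.∸ r ≡ 0 → ι s₁ * (1ℚ - remaining a) ≡ 0ℚ
    lemma (inj₁ s₁≡0) = trans (cong (λ n → ι n * (1ℚ - remaining a)) s₁≡0) (ℚ.*-zeroˡ (1ℚ - remaining a))
    lemma (inj₂ a≤r)  = trans (cong (λ n → ι s₁ * (1ℚ - (1ℚ - ι n * κ))) a≤r)
      (solve 2 (λ x κ → x :* (con 1ℚ :- (con 1ℚ :- con 0ℚ :* κ)) := con 0ℚ) refl (ι s₁) κ)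

  -- Both kinds of elements of `O` gain the same: a late one lowers `remaining` by `κ`, while an
  -- early one multiplies the discount by `1 - κ` at a moment when `remaining a` is 1.
  gain-inner : ∀ a c → g (a ℕ.+ 1) (c ℕ.+ 0) - g a c ≡ inner a c
  gain-inner a c with step a c 1 0
  ... | record { s₁ = 0 ; s₂ = 1 ; gain = gain } = trans gain
    (solve 3 (λ D P κ → D :* (P :- (P :- (con 1ℚ :+ con 0ℚ) :* κ) :* con 1ℚ) := D :* κ) refl
      (discount a c) (remaining a) κ)
  ... | record { s₁ = 1 ; s₂ = 0 ; gain = gain ; untouched = P≡1 } = trans gain (begin
    D * (P - (P - 0ℚ * κ) * ((1ℚ - κ) * 1ℚ))
      ≡⟨ solve 3 (λ D P κ → D :* (P :- (P :- con 0ℚ :* κ) :* ((con 1ℚ :- κ) :* con 1ℚ))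
                         := D :* κ :- D :* κ :* ((con 1ℚ :+ con 0ℚ) :* (con 1ℚ :- P))) refl D P κ ⟩
    D * κ - D * κ * ((1ℚ + 0ℚ) * (1ℚ - P))
      ≡⟨ cong (λ z → D * κ - D * κ * z) P≡1 ⟩
    D * κ - D * κ * 0ℚ
      ≡⟨ solve 1 (λ x → x :- x :* con 0ℚ := x) refl (D * κ) ⟩
    D * κ ∎)
    where
    open ≡-Reasoning
    D = discount a c
    P = remaining a

  gain-outer : ∀ a c → g (a ℕ.+ 0) (c ℕ.+ 1) - g a c ≡ outer a c
  gain-outer a c with step a c 0 1
  ... | record { s₁ = 0 ; s₂ = 0 ; gain = gain } = trans gain
    (solve 3 (λ D P κ → D :* (P :- (P :- con 0ℚ :* κ) :* ((con 1ℚ :- κ) :* con 1ℚ)) := D :* (P :* κ)) refl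
      (discount a c) (remaining a) κ)

  -- This yields γ = 1. Bernoulli's inequality bounds `w` from below, `a + s ≤ k` keeps the mass
  -- that it multiplies nonnegative, and the cross terms left over in `core` are nonnegative.
  gain-≤ : ∀ a c s t → a ℕ.+ s ℕ.≤ k →
    g (a ℕ.+ s) (c ℕ.+ t) - g a c ≤ ι s * inner a c + ι t * outer a c
  gain-≤ a c s t a+s≤k with step a c s t
  ... | record { s₁ = s₁ ; s₂ = s₂ ; s₁+s₂ = refl ; gain = gain ; remaining-step = rem } = begin
    g (a ℕ.+ s) (c ℕ.+ t) - g a c
      ≡⟨ gain ⟩
    D * (P - (P - x₂ * κ) * w)
      ≤⟨ *-monoˡ D (0≤q^ (a ℕ.⊓ r ℕ.+ c)) core ⟩
    D * ((x₁ + x₂) * κ + y * (P * κ))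
      ≡⟨ solve 5 (λ D x y P κ → D :* (x :* κ :+ y :* (P :* κ)) := x :* (D :* κ) :+ y :* (D :* (P :* κ))) refl
           D (x₁ + x₂) y P κ ⟩
    (x₁ + x₂) * inner a c + y * outer a c
      ≡⟨ cong (λ x → x * inner a c + y * outer a c) (sym (ι-+ s₁ s₂)) ⟩
    ι s * inner a c + ι t * outer a c ∎
    where
    open ℚ.≤-Reasoning
    D = discount a c
    P = remaining a
    x₁ = ι s₁
    x₂ = ι s₂
    y = ι t
    w = q ^ (s₁ ℕ.+ t)
    0≤P′ : 0ℚ ≤ P - x₂ * κ
    0≤P′ = subst (0ℚ ≤_) rem (0≤remaining a+s≤k)
    0≤x₂κ : 0ℚ ≤ x₂ * κ
    0≤x₂κ = 0≤* (0≤ι s₂) 0≤κ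
    w≥ : 1ℚ - (x₁ + y) * κ ≤ w
    w≥ = subst (λ z → 1ℚ - z * κ ≤ w) (ι-+ s₁ t) (bernoulli (s₁ ℕ.+ t))
    core : P - (P - x₂ * κ) * w ≤ (x₁ + x₂) * κ + y * (P * κ)
    core = 0≤-⇒≤ (subst (0ℚ ≤_)
      (solve 6 (λ P x₁ x₂ y κ w →
          (P :- x₂ :* κ) :* (w :- (con 1ℚ :- (x₁ :+ y) :* κ))
            :+ (x₁ :* κ :* ((con 1ℚ :- P) :+ x₂ :* κ) :+ y :* κ :* (x₂ :* κ))
          := ((x₁ :+ x₂) :* κ :+ y :* (P :* κ)) :- (P :- (P :- x₂ :* κ) :* w)) refl P x₁ x₂ y κ w)
      (0≤+ (0≤* 0≤P′ (≤⇒0≤- w≥))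
        (0≤+ (0≤* (0≤* (0≤ι s₁) 0≤κ) (0≤+ (≤⇒0≤- (remaining≤1 a)) 0≤x₂κ))
             (0≤* (0≤* (0≤ι t) 0≤κ) 0≤x₂κ))))

  -- This yields β ≥ ½. Now `q^-upper` bounds `w` from above, for which `s + t ≤ k` is required;
  -- what is left over for the late elements is `B`.
  gain-≥ : ∀ a c s t → a ℕ.+ s ℕ.≤ k → s ℕ.+ t ℕ.≤ k →
    ½ * (ι s * inner a c + ι t * outer a c) ≤ g (a ℕ.+ s) (c ℕ.+ t) - g a c
  gain-≥ a c s t a+s≤k s+t≤k with step a c s t
  ... | record { s₁ = s₁ ; s₂ = s₂ ; s₁+s₂ = refl ; gain = gain ; remaining-step = rem
               ; untouched = untouched } = begin
    ½ * (ι s * inner a c + ι t * outer a c)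
      ≡⟨ cong (λ x → ½ * (x * inner a c + y * outer a c)) (ι-+ s₁ s₂) ⟩
    ½ * ((x₁ + x₂) * inner a c + y * outer a c)
      ≡⟨ solve 5 (λ D x y P κ → con ½ :* (x :* (D :* κ) :+ y :* (D :* (P :* κ)))
                             := D :* (con ½ :* (x :* κ :+ y :* (P :* κ)))) refl D (x₁ + x₂) y P κ ⟩
    D * (½ * ((x₁ + x₂) * κ + y * (P * κ)))
      ≤⟨ *-monoˡ D (0≤q^ (a ℕ.⊓ r ℕ.+ c)) core ⟩
    D * (P - (P - x₂ * κ) * w)
      ≡⟨ sym gain ⟩
    g (a ℕ.+ s) (c ℕ.+ t) - g a c ∎
    where
    open ℚ.≤-Reasoning
    D = discount a c
    P = remaining a
    x₁ = ι s₁
    x₂ = ι s₂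
    y = ι t
    w = q ^ (s₁ ℕ.+ t)
    0≤P′ : 0ℚ ≤ P - x₂ * κ
    0≤P′ = subst (0ℚ ≤_) rem (0≤remaining a+s≤k)
    s₁+t≤k : s₁ ℕ.+ t ℕ.≤ k
    s₁+t≤k = ℕ.≤-trans (ℕ.+-monoˡ-≤ t (ℕ.m≤m+n s₁ s₂)) s+t≤k
    w≤ : w ≤ 1ℚ - ½ * ((x₁ + y) * κ)
    w≤ = subst (λ z → w ≤ 1ℚ - ½ * (z * κ)) (ι-+ s₁ t) (q^-upper (s₁ ℕ.+ t) (ικ≤1 s₁+t≤k))
    wκ≤1 : (x₁ + y) * κ ≤ 1ℚ
    wκ≤1 = subst (λ z → z * κ ≤ 1ℚ) (ι-+ s₁ t) (ικ≤1 s₁+t≤k)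
    core : ½ * ((x₁ + x₂) * κ + y * (P * κ)) ≤ P - (P - x₂ * κ) * w
    core = 0≤-⇒≤ (subst (0ℚ ≤_) identity
      (0≤+ (0≤* 0≤P′ (≤⇒0≤- w≤)) (0≤* 0≤½ (0≤* (0≤* (0≤ι s₂) 0≤κ) (≤⇒0≤- wκ≤1)))))
      where
      A = (P - x₂ * κ) * (1ℚ - ½ * ((x₁ + y) * κ) - w)
      B = ½ * (x₂ * κ * (1ℚ - (x₁ + y) * κ))
      identity : A + B ≡ P - (P - x₂ * κ) * w - ½ * ((x₁ + x₂) * κ + y * (P * κ))
      identity = begin-equality
        A + B
          ≡⟨ solve 2 (λ z κ → z := z :- con ½ :* κ :* con 0ℚ) refl (A + B) κ ⟩
        A + B - ½ * κ * 0ℚ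
          -- Each of the `s₁` early elements has to account for `κ`, whereas `A` supplies `P * κ`.
          -- The difference vanishes by `untouched`.
          ≡⟨ cong (λ z → A + B - ½ * κ * z) (sym untouched) ⟩
        A + B - ½ * κ * (x₁ * (1ℚ - P))
          ≡⟨ solve 6 (λ P x₁ x₂ y κ w →
               (P :- x₂ :* κ) :* (con 1ℚ :- con ½ :* ((x₁ :+ y) :* κ) :- w)
                 :+ con ½ :* (x₂ :* κ :* (con 1ℚ :- (x₁ :+ y) :* κ)) :- con ½ :* κ :* (x₁ :* (con 1ℚ :- P))
               := P :- (P :- x₂ :* κ) :* w :- con ½ :* ((x₁ :+ x₂) :* κ :+ y :* (P :* κ))) refl P x₁ x₂ y κ w ⟩
        P - (P - x₂ * κ) * w - ½ * ((x₁ + x₂) * κ + y * (P * κ)) ∎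

-- Supermodularity ratios of rational-valued functions

pointwise⇒≤ℝ : ∀ x y → (∀ n → seq x n ≤ seq y n) → x ≤ℝ y
pointwise⇒≤ℝ x y x≤y ε 0<ε = 0 , λ n _ →
  ℚ.≤-trans (x≤y n) (≤-offset ε (ℚ.<⇒≤ 0<ε) refl)

fromℚ-mono : ∀ {p q} → p ≤ q → fromℚ p ≤ℝ fromℚ q
fromℚ-mono {p} {q} p≤q = pointwise⇒≤ℝ (fromℚ p) (fromℚ q) λ _ → p≤q

-- Membership in the class asks for a largest real β. With finitely many rational constraints it is
-- the minimum of 1 and of quotients `B x / A x`, hence rational and computable.
record LargestScalar {X : Set} (A B : X → ℚ) (xs : List X) : Set where
  field
    β           : ℚ
    ½≤β         : ½ ≤ β
    β≤1         : β ≤ 1ℚ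
    satisfies   : All (λ x → β * A x ≤ B x) xs
    largest     : ∀ y → y ≤ℝ 1ℝ → All (λ x → y *ℝ fromℚ (A x) ≤ℝ fromℚ (B x)) xs → y ≤ℝ fromℚ β

largestScalar : ∀ {X : Set} (A B : X → ℚ) xs → All (λ x → 0ℚ ≤ A x × ½ * A x ≤ B x) xs → LargestScalar A B xs
largestScalar A B [] [] = record
  { β = 1ℚ ; ½≤β = ℚ.≤ᵇ⇒≤ {½} {1ℚ} _ ; β≤1 = ℚ.≤-refl ; satisfies = [] ; largest = λ y y≤1 _ → y≤1 }
largestScalar A B (x ∷ xs) ((0≤A , ½A≤B) ∷ h) with largestScalar A B xs h
... | L with LargestScalar.β L * A x ℚ.≤? B x
... | yes βA≤B = record
  { β = β ; ½≤β = ½≤β ; β≤1 = β≤1 ; satisfies = βA≤B ∷ satisfies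
  ; largest = λ { y y≤1 (_ ∷ yA≤B) → largest y y≤1 yA≤B } }
  where open LargestScalar L
... | no  βA≰B = record
  { β = β′ ; ½≤β = ℚ.*-cancelʳ-≤-pos (A x) (subst (½ * A x ≤_) (sym β′A≡B) ½A≤B)
  ; β≤1 = ℚ.≤-trans β′≤β β≤1
  ; satisfies = ℚ.≤-reflexive β′A≡B ∷
      All.zipWith (λ { {z} ((0≤Az , _) , βA≤B) → ℚ.≤-trans (*-monoʳ (A z) 0≤Az β′≤β) βA≤B }) (h , satisfies)
  ; largest = λ { y _ (yA≤B ∷ _) → y≤β′ y yA≤B } }
  where
  open LargestScalar L
  B<βA : B x < β * A x
  B<βA = ℚ.≰⇒> βA≰B
  -- With `A x = 0` the hypothesis `½ * A x ≤ B x` would already give the constraint that fails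
  -- here.
  A≢0 : A x ≢ 0ℚ
  A≢0 A≡0 = ℚ.<-irrefl refl (begin-strict
    0ℚ        ≡⟨ sym (ℚ.*-zeroʳ ½) ⟩
    ½ * 0ℚ    ≡⟨ cong (½ *_) (sym A≡0) ⟩
    ½ * A x   ≤⟨ ½A≤B ⟩
    B x       <⟨ B<βA ⟩
    β * A x   ≡⟨ cong (β *_) A≡0 ⟩
    β * 0ℚ    ≡⟨ ℚ.*-zeroʳ β ⟩
    0ℚ        ∎)
    where open ℚ.≤-Reasoning
  0<A : 0ℚ < A x
  0<A = ℚ.≰⇒> λ A≤0 → A≢0 (ℚ.≤-antisym A≤0 0≤A)
  instance
    _ = positive 0<A
    _ = ℚ.pos⇒nonZero (A x)
  1/A = 1/ A x
  β′ = B x * 1/A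
  scale : ∀ p → (p * 1/A) * A x ≡ p
  scale p = trans (ℚ.*-assoc p 1/A (A x)) (trans (cong (p *_) (ℚ.*-inverseˡ (A x))) (ℚ.*-identityʳ p))
  β′A≡B : β′ * A x ≡ B x
  β′A≡B = scale (B x)
  β′≤β : β′ ≤ β
  β′≤β = ℚ.*-cancelʳ-≤-pos (A x) (subst (_≤ β * A x) (sym β′A≡B) (ℚ.<⇒≤ B<βA))
  y≤β′ : ∀ y → y *ℝ fromℚ (A x) ≤ℝ fromℚ (B x) → y ≤ℝ fromℚ β′
  -- Precision `ε * A x` becomes `ε` after division by `A x`.
  y≤β′ y yA≤B ε 0<ε with yA≤B (ε * A x) (subst (_< ε * A x) (ℚ.*-zeroˡ (A x)) (ℚ.*-monoˡ-<-pos (A x) 0<ε))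
  ... | N , bound = N , λ n N≤n → ℚ.*-cancelʳ-≤-pos (A x) (begin
    seq y n * A x            ≤⟨ bound n N≤n ⟩
    B x + ε * A x            ≡⟨ cong (_+ ε * A x) (sym β′A≡B) ⟩
    β′ * A x + ε * A x       ≡⟨ sym (ℚ.*-distribʳ-+ (A x) β′ ε) ⟩
    (β′ + ε) * A x           ∎)
    where open ℚ.≤-Reasoning

-- The hard functions and their membership in the problem class.

allSubsets : ∀ d → List (Subset d)
allSubsets zero    = [] ∷ []
allSubsets (suc d) = map (inside ∷_) (allSubsets d) ++ˡ map (outside ∷_) (allSubsets d)

∈-allSubsets : ∀ {d} (S : Subset d) → S ∈ˡ allSubsets d
∈-allSubsets []            = Any.here refl
∈-allSubsets (inside ∷ S)  = ∈-++⁺ˡ (∈-map⁺ (inside ∷_) (∈-allSubsets S))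
∈-allSubsets (outside ∷ S) = ∈-++⁺ʳ (map (inside ∷_) (allSubsets _)) (∈-map⁺ (outside ∷_) (∈-allSubsets S))

module SetValues (κ : ℚ) (0≤κ : 0ℚ ≤ κ) (κ≤1 : κ ≤ 1ℚ) (r k : ℕ) (kκ≡1 : ι k * κ ≡ 1ℚ) (1≤k : 1 ℕ.≤ k) where

  open Values κ 0≤κ κ≤1 r k kκ≡1

  -- The ratios involve only sets of size at most 2k, so all larger sets may be
  -- given the value 1, and then reveal nothing about O.
  value : ∀ {d} → Subset d → Subset d → ℚ
  value O S = if does (∥ S ∥ ℕ.≤? k ℕ.+ k) then g ∥ S ∩ O ∥ ∥ S ∩ ∁ O ∥ else 1ℚ

  value-small : ∀ {d} (O S : Subset d) → ∥ S ∥ ℕ.≤ k ℕ.+ k → value O S ≡ g ∥ S ∩ O ∥ ∥ S ∩ ∁ O ∥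
  value-small O S S≤2k = cong (if_then g ∥ S ∩ O ∥ ∥ S ∩ ∁ O ∥ else 1ℚ) (dec-true (∥ S ∥ ℕ.≤? k ℕ.+ k) S≤2k)

  value-large : ∀ {d} (O S : Subset d) → ¬ ∥ S ∥ ℕ.≤ k ℕ.+ k → value O S ≡ 1ℚ
  value-large O S S≰2k = cong (if_then g ∥ S ∩ O ∥ ∥ S ∩ ∁ O ∥ else 1ℚ) (dec-false (∥ S ∥ ℕ.≤? k ℕ.+ k) S≰2k)

  value-⊥ : ∀ {d} (O : Subset d) → value O ⊥ ≡ 0ℚ
  value-⊥ {d} O = begin
    value O ⊥                       ≡⟨ value-small O ⊥ (subst (ℕ._≤ k ℕ.+ k) (sym (∣⊥∣≡0 d)) z≤n) ⟩
    g ∥ ⊥ ∩ O ∥ ∥ ⊥ ∩ ∁ O ∥         ≡⟨ cong₂ g (∥⊥∩∥ O) (∥⊥∩∥ (∁ O)) ⟩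
    g 0 0                           ≡⟨ g-hidden 0 z≤n ⟩
    0ℚ                              ∎
    where open ≡-Reasoning

  module _ {d} (O : Subset d) (O≤k : ∥ O ∥ ℕ.≤ k) where

    ∩O≤k : ∀ S → ∥ S ∩ O ∥ ℕ.≤ k
    ∩O≤k S = ℕ.≤-trans (∣p∩q∣≤∣q∣ S O) O≤k

    value≤1 : ∀ S → value O S ≤ 1ℚ
    value≤1 S with ∥ S ∥ ℕ.≤? k ℕ.+ k
    ... | yes S≤2k = subst (_≤ 1ℚ) (sym (value-small O S S≤2k)) (g≤1 ∥ S ∩ ∁ O ∥ (∩O≤k S))
    ... | no  S≰2k = ℚ.≤-reflexive (value-large O S S≰2k)

    value-mono : ∀ S T → value O S ≤ value O (S ∪ T)
    value-mono S T with ∥ S ∪ T ∥ ℕ.≤? k ℕ.+ k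
    ... | no  ≰2k = subst (value O S ≤_) (sym (value-large O (S ∪ T) ≰2k)) (value≤1 S)
    ... | yes ≤2k = subst₂ _≤_
      (sym (value-small O S (ℕ.≤-trans (∣p∣≤∣p∪q∣ S T) ≤2k))) (sym (value-small O (S ∪ T) ≤2k))
      (g-mono (∩-mono O) (∩O≤k (S ∪ T)) (∩-mono (∁ O)))
      where
      ∩-mono : ∀ R → ∥ S ∩ R ∥ ℕ.≤ ∥ (S ∪ T) ∩ R ∥
      ∩-mono R = p⊆q⇒∣p∣≤∣q∣ λ x∈ → let (x∈S , x∈R) = x∈p∩q⁻ S R x∈ in x∈p∩q⁺ (p⊆p∪q T x∈S , x∈R)

    gains : Subset d → Subset d → ℚ
    gains L T = ∑ℚ T (λ j → value O (L ∪ ⁅ j ⁆) - value O L)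

    marginalValue : Subset d → Subset d → ℚ
    marginalValue L T = value O (L ∪ T) - value O L

    Valid : Subset d × Subset d → Set
    Valid (L , T) = Empty (L ∩ T) × ∥ L ∥ ℕ.≤ k × ∥ T ∥ ℕ.≤ k

    -- Decidability turns the constraints that define the supermodularity ratio into a finite list.
    valid? : ∀ LT → Dec (Valid LT)
    valid? (L , T) = ¬? (nonempty? (L ∩ T)) ×-dec (∥ L ∥ ℕ.≤? k) ×-dec (∥ T ∥ ℕ.≤? k)

    -- Both `L` and `L ∪ T` have at most `2k` elements, so the default value 1 does not enter.
    marginalValue≡ : ∀ {L T} → Valid (L , T) →
      marginalValue L T ≡ g (∥ L ∩ O ∥ ℕ.+ ∥ T ∩ O ∥) (∥ L ∩ ∁ O ∥ ℕ.+ ∥ T ∩ ∁ O ∥) - g ∥ L ∩ O ∥ ∥ L ∩ ∁ O ∥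
    marginalValue≡ {L} {T} (L∩T=∅ , L≤k , T≤k) = cong₂ _-_
      (trans (value-small O (L ∪ T) (subst (ℕ._≤ k ℕ.+ k) (sym (∥∪∥ L T L∩T=∅)) (ℕ.+-mono-≤ L≤k T≤k)))
             (cong₂ g (∥∪∩∥ L T O L∩T=∅) (∥∪∩∥ L T (∁ O) L∩T=∅)))
      (value-small O L (ℕ.m≤n⇒m≤n+o k L≤k))

    marginalValue-⁅⁆ : ∀ {L T j} → Valid (L , T) → j ∈ T →
      marginalValue L ⁅ j ⁆
      ≡ g (∥ L ∩ O ∥ ℕ.+ ∥ ⁅ j ⁆ ∩ O ∥) (∥ L ∩ ∁ O ∥ ℕ.+ ∥ ⁅ j ⁆ ∩ ∁ O ∥) - g ∥ L ∩ O ∥ ∥ L ∩ ∁ O ∥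
    marginalValue-⁅⁆ {L} {T} {j} (L∩T=∅ , L≤k , T≤k) j∈T = marginalValue≡ {L} {⁅ j ⁆}
      (Empty-∩⁅⁆ L∩T=∅ j∈T , L≤k , subst (ℕ._≤ k) (sym (∣⁅x⁆∣≡1 j)) 1≤k)

    module _ {L T} (valid : Valid (L , T)) where

      private
        a = ∥ L ∩ O ∥
        c = ∥ L ∩ ∁ O ∥

      gains≡ : gains L T ≡ ι ∥ T ∩ O ∥ * inner a c + ι ∥ T ∩ ∁ O ∥ * outer a c
      gains≡ = ∑ℚ-two-valued T O _ (inner a c) (outer a c)
        (λ j j∈T j∈O → trans (marginalValue-⁅⁆ valid j∈T)
          (trans (cong₂ (λ m n → g (a ℕ.+ m) (c ℕ.+ n) - g a c)
                    (∥⁅⁆∩∥-∈ j∈O) (∥⁅⁆∩∥-∉ λ j∈∁O → x∈∁p⇒x∉p j∈∁O j∈O))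
                 (gain-inner a c)))
        (λ j j∈T j∉O → trans (marginalValue-⁅⁆ valid j∈T)
          (trans (cong₂ (λ m n → g (a ℕ.+ m) (c ℕ.+ n) - g a c)
                    (∥⁅⁆∩∥-∉ j∉O) (∥⁅⁆∩∥-∈ (x∉p⇒x∈∁p j∉O)))
                 (gain-outer a c)))

      -- `L ∪ T` may have up to `2k` elements, but its hits lie in `O`.
      a+s≤k : ∥ L ∩ O ∥ ℕ.+ ∥ T ∩ O ∥ ℕ.≤ k
      a+s≤k = subst (ℕ._≤ k) (∥∪∩∥ L T O (proj₁ valid)) (∩O≤k (L ∪ T))

      marginalValue≤gains : marginalValue L T ≤ gains L T
      marginalValue≤gains = subst₂ _≤_ (sym (marginalValue≡ valid)) (sym gains≡)
        (gain-≤ a c ∥ T ∩ O ∥ ∥ T ∩ ∁ O ∥ a+s≤k)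

      ½gains≤marginalValue : ½ * gains L T ≤ marginalValue L T
      ½gains≤marginalValue = subst₂ (λ x y → ½ * x ≤ y) (sym gains≡) (sym (marginalValue≡ valid))
        (gain-≥ a c ∥ T ∩ O ∥ ∥ T ∩ ∁ O ∥ a+s≤k
          (subst (ℕ._≤ k) (sym (∥∩∥+∥∩∁∥ T O)) (proj₂ (proj₂ valid))))

      0≤gains : 0ℚ ≤ gains L T
      0≤gains = ℚ.≤-trans (≤⇒0≤- (value-mono L T)) marginalValue≤gains

    valueFunction : SetFunction d
    valueFunction S = fromℚ (value O S)

    seq-gains : ∀ L T n → seq (∑[ T ] (λ j → marginal valueFunction ⁅ j ⁆ L)) n ≡ gains L T
    seq-gains L T = seq-∑ T (λ j → marginal valueFunction ⁅ j ⁆ L)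

    pairs : List (Subset d × Subset d)
    pairs = cartesianProduct (allSubsets d) (allSubsets d)

    validPairs : List (Subset d × Subset d)
    validPairs = filter valid? pairs

    ∈-validPairs⁺ : ∀ {L T} → Valid (L , T) → (L , T) ∈ˡ validPairs
    ∈-validPairs⁺ {L} {T} = ∈-filter⁺ valid? (∈-cartesianProduct⁺ (∈-allSubsets L) (∈-allSubsets T))

    ∈-validPairs⁻ : ∀ {LT} → LT ∈ˡ validPairs → Valid LT
    ∈-validPairs⁻ LT∈ = proj₂ (∈-filter⁻ valid? {xs = pairs} LT∈)

    largestRatio : LargestScalar (λ (L , T) → gains L T) (λ (L , T) → marginalValue L T) validPairs
    largestRatio = largestScalar _ _ validPairs
      (All.tabulate λ LT∈ → let valid = ∈-validPairs⁻ LT∈ in 0≤gains valid , ½gains≤marginalValue valid)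

    open LargestScalar largestRatio

    -- As 1 is the top of the unit interval, only admissibility is at stake, and that is
    -- `marginalValue≤gains`.
    submodularityRatio-1 : IsSubmodularityRatio valueFunction k 1ℝ
    submodularityRatio-1 = (fromℚ-mono 0≤1 , fromℚ-mono ℚ.≤-refl , inequality) , λ y (_ , y≤1 , _) → y≤1
      where
      inequality : SubmodularityInequality valueFunction k 1ℝ
      inequality L T L∩T=∅ L≤k T≤k = pointwise⇒≤ℝ
        (1ℝ *ℝ marginal valueFunction T L) (∑[ T ] (λ j → marginal valueFunction ⁅ j ⁆ L))
        λ n → subst₂ _≤_ (sym (ℚ.*-identityˡ (marginalValue L T))) (sym (seq-gains L T n))
                (marginalValue≤gains (L∩T=∅ , L≤k , T≤k))

    supermodularityRatio-β : IsSupermodularityRatio valueFunction k (fromℚ β)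
    supermodularityRatio-β =
      (fromℚ-mono (ℚ.≤-trans 0≤½ ½≤β) , fromℚ-mono β≤1 , inequality) ,
      λ y (_ , y≤1 , yA≤B) → largest y y≤1 (All.tabulate λ { {L , T} LT∈ ε 0<ε →
        let (L∩T=∅ , L≤k , T≤k) = ∈-validPairs⁻ LT∈
            (N , bound)         = yA≤B L T L∩T=∅ L≤k T≤k ε 0<ε
        in N , λ n N≤n →
             subst (λ z → seq y n * z ≤ marginalValue L T + ε) (seq-gains L T n) (bound n N≤n) })
      where
      inequality : SupermodularityInequality valueFunction k (fromℚ β)
      inequality L T L∩T=∅ L≤k T≤k = pointwise⇒≤ℝ
        (fromℚ β *ℝ ∑[ T ] (λ j → marginal valueFunction ⁅ j ⁆ L)) (marginal valueFunction T L)
        λ n → subst (λ z → β * z ≤ marginalValue L T) (sym (seq-gains L T n))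
                (All.lookup satisfies (∈-validPairs⁺ (L∩T=∅ , L≤k , T≤k)))

    inClass : ∀ b → b k ≤ℝ ½ℝ → InClass b k valueFunction
    inClass b b≤½ = record
      { monotone = λ S T →
          pointwise⇒≤ℝ 0ℝ (marginal valueFunction T S) λ _ → ≤⇒0≤- (value-mono S T)
      ; normalized =
          fromℚ-mono (ℚ.≤-reflexive (value-⊥ O)) , fromℚ-mono (ℚ.≤-reflexive (sym (value-⊥ O)))
      ; submodularityRatio   = submodularityRatio-1
      ; supermodularityRatio = fromℚ β , supermodularityRatio-β , λ ε 0<ε →
          let (N , bound) = b≤½ ε 0<ε
          in N , λ n N≤n → ℚ.≤-trans (bound n N≤n) (ℚ.+-monoˡ-≤ ε ½≤β)
      }

    -- The guarantee refers to an exact maximum, of which the later argument uses that it is at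
    -- least the value of `O`. Rational values make it computable by enumeration.
    maximum : ∃[ S ] ∥ S ∥ ℕ.≤ k × (∀ S′ → ∥ S′ ∥ ℕ.≤ k → value O S′ ≤ value O S)
    maximum = argmax (value O) ⊥ candidates ,
      argmax-all (value O) {P = λ S → ∥ S ∥ ℕ.≤ k} {⊥} {candidates} (subst (ℕ._≤ k) (sym (∣⊥∣≡0 d)) z≤n)
        (All.tabulate λ S∈ → proj₂ (∈-filter⁻ (λ S → ∥ S ∥ ℕ.≤? k) {xs = allSubsets d} S∈)) ,
      λ S′ S′≤k → All.lookup (f[xs]≤f[argmax] ⊥ candidates)
        (∈-filter⁺ (λ S → ∥ S ∥ ℕ.≤? k) (∈-allSubsets S′) S′≤k)
      where
      candidates : List (Subset d)
      candidates = filter (λ S → ∥ S ∥ ℕ.≤? k) (allSubsets d)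

-- Counting transversals of k blocks of size n

-- Divided by `n ^ k`, the expectation of `f` over independent uniform choices, one in each block.
-- Without the division, all counting stays in ℕ.
sumFunctions : ∀ {n} k → (Vec (Fin n) k → ℕ) → ℕ
sumFunctions zero    f = f []
sumFunctions (suc k) f = sum λ j → sumFunctions k (f ∘ (j ∷_))

sumFunctions-cong : ∀ {n} k {f g : Vec (Fin n) k → ℕ} → (∀ x → f x ≡ g x) → sumFunctions k f ≡ sumFunctions k g
sumFunctions-cong zero    f≡g = f≡g []
sumFunctions-cong (suc k) f≡g = sum-cong-≗ λ j → sumFunctions-cong k (f≡g ∘ (j ∷_))

sumFunctions-+ : ∀ {n} k (f g : Vec (Fin n) k → ℕ) →
  sumFunctions k (λ x → f x ℕ.+ g x) ≡ sumFunctions k f ℕ.+ sumFunctions k g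
sumFunctions-+ zero    f g = refl
sumFunctions-+ (suc k) f g = trans (sum-cong-≗ λ j → sumFunctions-+ k (f ∘ (j ∷_)) (g ∘ (j ∷_)))
  (∑-distrib-+ (λ j → sumFunctions k (f ∘ (j ∷_))) (λ j → sumFunctions k (g ∘ (j ∷_))))

sum-constant : ∀ n m → sum {n} (λ _ → m) ≡ n ℕ.* m
sum-constant zero    m = refl
sum-constant (suc n) m = cong (m ℕ.+_) (sum-constant n m)

sumFunctions-1 : ∀ {n} k → sumFunctions {n} k (λ _ → 1) ≡ n ℕ.^ k
sumFunctions-1 zero        = refl
sumFunctions-1 {n} (suc k) = trans (sum-cong-≗ {n} λ _ → sumFunctions-1 k) (sum-constant n (n ℕ.^ k))

sumFunctions-0 : ∀ {n} k → sumFunctions {n} k (λ _ → 0) ≡ 0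
sumFunctions-0 zero        = refl
sumFunctions-0 {n} (suc k) = trans (sum-cong-≗ {n} λ _ → sumFunctions-0 k)
  (trans (sum-constant n 0) (ℕ.*-zeroʳ n))

sum-pigeonhole : ∀ {n m} (h : Fin n → ℕ) → sum h ℕ.< n ℕ.* m → ∃[ j ] h j ℕ.< m
sum-pigeonhole {suc n} {m} h Σ<nm with h zero ℕ.<? m
... | yes h₀<m = zero , h₀<m
... | no  h₀≮m with sum-pigeonhole (h ∘ suc) (ℕ.+-cancelˡ-< m _ _
                      (ℕ.≤-<-trans (ℕ.+-monoˡ-≤ (sum (h ∘ suc)) (ℕ.≮⇒≥ h₀≮m)) Σ<nm))
... | j , hⱼ<m = suc j , hⱼ<m

sumFunctions-pigeonhole : ∀ {n} k (f : Vec (Fin n) k → ℕ) → sumFunctions k f ℕ.< n ℕ.^ k → ∃[ x ] f x ≡ 0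
sumFunctions-pigeonhole zero    f Σ<1 = [] , ℕ.n<1⇒n≡0 Σ<1
sumFunctions-pigeonhole (suc k) f Σ<  with sum-pigeonhole (λ j → sumFunctions k (f ∘ (j ∷_))) Σ<
... | j , Σⱼ< with sumFunctions-pigeonhole k (f ∘ (j ∷_)) Σⱼ<
... | x , fx≡0 = j ∷ x , fx≡0

-- Points outside `Q` are charged as if there were `n` of them, which avoids a subtraction and is
-- sharp enough for the union bound.
sum-two-valued : ∀ {n} (Q : Subset n) h {x y} →
  (∀ {j} → j ∈ Q → h j ≡ x) → (∀ {j} → j ∉ Q → h j ≡ y) → sum h ℕ.≤ ∥ Q ∥ ℕ.* x ℕ.+ n ℕ.* y
sum-two-valued [] h ∈Q ∉Q = z≤n
sum-two-valued {suc n} (inside ∷ Q) h {x} {y} ∈Q ∉Q = begin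
  h zero ℕ.+ sum (h ∘ suc)
    ≤⟨ ℕ.+-mono-≤ (ℕ.≤-reflexive (∈Q here))
         (sum-two-valued Q (h ∘ suc) (∈Q ∘ there) (λ j∉Q → ∉Q λ { (there j∈Q) → j∉Q j∈Q })) ⟩
  x ℕ.+ (∥ Q ∥ ℕ.* x ℕ.+ n ℕ.* y)
    ≡⟨ sym (ℕ.+-assoc x (∥ Q ∥ ℕ.* x) (n ℕ.* y)) ⟩
  suc ∥ Q ∥ ℕ.* x ℕ.+ n ℕ.* y
    ≤⟨ ℕ.+-monoʳ-≤ (suc ∥ Q ∥ ℕ.* x) (ℕ.m≤n+m (n ℕ.* y) y) ⟩
  suc ∥ Q ∥ ℕ.* x ℕ.+ suc n ℕ.* y ∎
  where open ℕ.≤-Reasoning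
sum-two-valued {suc n} (outside ∷ Q) h {x} {y} ∈Q ∉Q = begin
  h zero ℕ.+ sum (h ∘ suc)
    ≤⟨ ℕ.+-mono-≤ (ℕ.≤-reflexive (∉Q λ ()))
         (sum-two-valued Q (h ∘ suc) (∈Q ∘ there) (λ j∉Q → ∉Q λ { (there j∈Q) → j∉Q j∈Q })) ⟩
  y ℕ.+ (∥ Q ∥ ℕ.* x ℕ.+ n ℕ.* y)
    ≡⟨ ℕ-solve 3 (λ a b c → a ⊕ (b ⊕ c) ⊜ b ⊕ (a ⊕ c)) refl y (∥ Q ∥ ℕ.* x) (n ℕ.* y) ⟩
  ∥ Q ∥ ℕ.* x ℕ.+ suc n ℕ.* y ∎
  where open ℕ.≤-Reasoning

-- One point per block instead of an arbitrary `k`-set: the choices are independent, so the union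
-- bound goes by induction on the blocks.
transversal : ∀ k {n} → Vec (Fin n) k → Subset (k ℕ.* n)
transversal zero    []      = []
transversal (suc k) (j ∷ x) = ⁅ j ⁆ ++ transversal k x

∥++∥ : ∀ {m n} (S : Subset m) (T : Subset n) → ∥ S ++ T ∥ ≡ ∥ S ∥ ℕ.+ ∥ T ∥
∥++∥ []            T = refl
∥++∥ (inside ∷ S)  T = cong suc (∥++∥ S T)
∥++∥ (outside ∷ S) T = ∥++∥ S T

∥transversal∥ : ∀ k {n} (x : Vec (Fin n) k) → ∥ transversal k x ∥ ≡ k
∥transversal∥ zero    []      = refl
∥transversal∥ (suc k) (j ∷ x) = trans (∥++∥ ⁅ j ⁆ (transversal k x))
  (cong₂ ℕ._+_ (∣⁅x⁆∣≡1 j) (∥transversal∥ k x))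

∥++∩transversal∥ : ∀ k {n} (P : Subset n) (Q : Subset (k ℕ.* n)) j x →
  ∥ (P ++ Q) ∩ transversal (suc k) (j ∷ x) ∥ ≡ ∥ ⁅ j ⁆ ∩ P ∥ ℕ.+ ∥ Q ∩ transversal k x ∥
∥++∩transversal∥ k P Q j x = trans (cong ∥_∥ (zipWith-++ _∧_ P Q ⁅ j ⁆ (transversal k x)))
  (trans (∥++∥ (P ∩ ⁅ j ⁆) (Q ∩ transversal k x))
    (cong (λ R → ∥ R ∥ ℕ.+ ∥ Q ∩ transversal k x ∥) (∩-comm P ⁅ j ⁆)))

-- Structural recursion lets one hit cancel by computation: `⟦ suc t ≤? suc m ⟧` reduces to
-- `⟦ t ≤? m ⟧`.
⟦_≤?_⟧ : ℕ → ℕ → ℕ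
⟦ zero  ≤? m ⟧ = 1
⟦ suc t ≤? zero ⟧ = 0
⟦ suc t ≤? suc m ⟧ = ⟦ t ≤? m ⟧

⟦≤?⟧≡0⇒> : ∀ t m → ⟦ t ≤? m ⟧ ≡ 0 → m ℕ.< t
⟦≤?⟧≡0⇒> (suc t) zero    _ = s≤s z≤n
⟦≤?⟧≡0⇒> (suc t) (suc m) h = s≤s (⟦≤?⟧≡0⇒> t m h)

meeting : ∀ {n} k → ℕ → Subset (k ℕ.* n) → ℕ
meeting k t Q = sumFunctions k λ x → ⟦ t ≤? ∥ Q ∩ transversal k x ∥ ⟧

-- A union bound over t-subsets of Q, with the probability multiplied by nᵏ⁺ᵗ.
meeting-bound : ∀ {n} k t (Q : Subset (k ℕ.* n)) → meeting k t Q ℕ.* n ℕ.^ t ℕ.≤ ∥ Q ∥ ℕ.^ t ℕ.* n ℕ.^ k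
meeting-bound {n} k zero Q = ℕ.≤-reflexive
  (trans (ℕ.*-identityʳ _) (trans (sumFunctions-1 k) (sym (ℕ.*-identityˡ (n ℕ.^ k)))))
meeting-bound zero (suc t) [] = z≤n
meeting-bound {n} (suc k) (suc t) PQ with splitAt n PQ
... | P , Q , refl = begin
  meeting (suc k) (suc t) (P ++ Q) ℕ.* n ℕ.^ suc t
    -- If the point of the first block lies in `P`, then `t` further hits remain to be found;
    -- otherwise `suc t` do.
    ≤⟨ ℕ.*-monoˡ-≤ (n ℕ.^ suc t) (sum-two-valued P _ ∈P ∉P) ⟩
  (∥ P ∥ ℕ.* x ℕ.+ n ℕ.* y) ℕ.* n ℕ.^ suc t
    ≡⟨ ℕ-solve 5 (λ p x n y N → (p ⊗ x ⊕ n ⊗ y) ⊗ (n ⊗ N) ⊜ n ⊗ (p ⊗ (x ⊗ N) ⊕ y ⊗ (n ⊗ N))) refl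
         ∥ P ∥ x n y (n ℕ.^ t) ⟩
  n ℕ.* (∥ P ∥ ℕ.* (x ℕ.* n ℕ.^ t) ℕ.+ y ℕ.* n ℕ.^ suc t)
    ≤⟨ ℕ.*-monoʳ-≤ n (ℕ.+-mono-≤ (ℕ.*-monoʳ-≤ ∥ P ∥ (meeting-bound k t Q)) (meeting-bound k (suc t) Q)) ⟩
  n ℕ.* (∥ P ∥ ℕ.* (∥ Q ∥ ℕ.^ t ℕ.* n ℕ.^ k) ℕ.+ ∥ Q ∥ ℕ.^ suc t ℕ.* n ℕ.^ k)
    ≡⟨ ℕ-solve 5 (λ p q Q n N → n ⊗ (p ⊗ (Q ⊗ N) ⊕ (q ⊗ Q) ⊗ N) ⊜ ((p ⊕ q) ⊗ Q) ⊗ (n ⊗ N)) refl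
         ∥ P ∥ ∥ Q ∥ (∥ Q ∥ ℕ.^ t) n (n ℕ.^ k) ⟩
  ((∥ P ∥ ℕ.+ ∥ Q ∥) ℕ.* ∥ Q ∥ ℕ.^ t) ℕ.* n ℕ.^ suc k
    -- With `p` and `q` the sizes of `P` and `Q`, the two cases add up to
    -- `p qᵗ + qᵗ⁺¹ = (p + q) qᵗ`, which is at most `(p + q)ᵗ⁺¹`.
    ≤⟨ ℕ.*-monoˡ-≤ (n ℕ.^ suc k) (ℕ.*-monoʳ-≤ (∥ P ∥ ℕ.+ ∥ Q ∥) (ℕ.^-monoˡ-≤ t (ℕ.m≤n+m ∥ Q ∥ ∥ P ∥))) ⟩
  (∥ P ∥ ℕ.+ ∥ Q ∥) ℕ.^ suc t ℕ.* n ℕ.^ suc k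
    ≡⟨ cong (λ m → m ℕ.^ suc t ℕ.* n ℕ.^ suc k) (sym (∥++∥ P Q)) ⟩
  ∥ P ++ Q ∥ ℕ.^ suc t ℕ.* n ℕ.^ suc k ∎
  where
  open ℕ.≤-Reasoning
  x = meeting k t Q
  y = meeting k (suc t) Q
  meets : Fin n → Vec (Fin n) k → ℕ
  meets j z = ⟦ suc t ≤? ∥ (P ++ Q) ∩ transversal (suc k) (j ∷ z) ∥ ⟧
  shift : ∀ {j m} → ∥ ⁅ j ⁆ ∩ P ∥ ≡ m → ∀ z → meets j z ≡ ⟦ suc t ≤? m ℕ.+ ∥ Q ∩ transversal k z ∥ ⟧
  shift {j} eq z = cong ⟦ suc t ≤?_⟧
    (trans (∥++∩transversal∥ k P Q j z) (cong (ℕ._+ ∥ Q ∩ transversal k z ∥) eq))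
  ∈P : ∀ {j} → j ∈ P → sumFunctions k (meets j) ≡ x
  ∈P {j} j∈P = sumFunctions-cong k (shift {j} (∥⁅⁆∩∥-∈ j∈P))
  ∉P : ∀ {j} → j ∉ P → sumFunctions k (meets j) ≡ y
  ∉P {j} j∉P = sumFunctions-cong k (shift {j} (∥⁅⁆∩∥-∉ j∉P))

totalMeeting : ∀ {n} k → ℕ → List (Subset (k ℕ.* n)) → Vec (Fin n) k → ℕ
totalMeeting k t Qs x = foldr (λ Q m → ⟦ t ≤? ∥ Q ∩ transversal k x ∥ ⟧ ℕ.+ m) 0 Qs

totalMeeting-bound : ∀ {n} k t w (Qs : List (Subset (k ℕ.* n))) → All (λ Q → ∥ Q ∥ ℕ.≤ w) Qs →
  sumFunctions k (totalMeeting k t Qs) ℕ.* n ℕ.^ t ℕ.≤ (length Qs ℕ.* w ℕ.^ t) ℕ.* n ℕ.^ k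
totalMeeting-bound {n} k t w [] [] = ℕ.≤-reflexive (cong (ℕ._* n ℕ.^ t) (sumFunctions-0 k))
totalMeeting-bound {n} k t w (Q ∷ Qs) (Q≤w ∷ Qs≤w) = begin
  sumFunctions k (totalMeeting k t (Q ∷ Qs)) ℕ.* n ℕ.^ t
    ≡⟨ cong (ℕ._* n ℕ.^ t) (sumFunctions-+ k (λ x → ⟦ t ≤? ∥ Q ∩ transversal k x ∥ ⟧) (totalMeeting k t Qs)) ⟩
  (meeting k t Q ℕ.+ sumFunctions k (totalMeeting k t Qs)) ℕ.* n ℕ.^ t
    ≡⟨ ℕ.*-distribʳ-+ (n ℕ.^ t) (meeting k t Q) _ ⟩
  meeting k t Q ℕ.* n ℕ.^ t ℕ.+ sumFunctions k (totalMeeting k t Qs) ℕ.* n ℕ.^ t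
    ≤⟨ ℕ.+-mono-≤ (ℕ.≤-trans (meeting-bound k t Q) (ℕ.*-monoˡ-≤ (n ℕ.^ k) (ℕ.^-monoˡ-≤ t Q≤w)))
                  (totalMeeting-bound k t w Qs Qs≤w) ⟩
  w ℕ.^ t ℕ.* n ℕ.^ k ℕ.+ (length Qs ℕ.* w ℕ.^ t) ℕ.* n ℕ.^ k
    ≡⟨ sym (ℕ.*-distribʳ-+ (n ℕ.^ k) (w ℕ.^ t) (length Qs ℕ.* w ℕ.^ t)) ⟩
  (length (Q ∷ Qs) ℕ.* w ℕ.^ t) ℕ.* n ℕ.^ k ∎
  where open ℕ.≤-Reasoning

totalMeeting≡0 : ∀ {n} k t (Qs : List (Subset (k ℕ.* n))) x → totalMeeting k t Qs x ≡ 0 →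
  All (λ Q → ∥ Q ∩ transversal k x ∥ ℕ.< t) Qs
totalMeeting≡0 k t []       x _ = []
totalMeeting≡0 k t (Q ∷ Qs) x h =
  ⟦≤?⟧≡0⇒> t _ (ℕ.m+n≡0⇒m≡0 _ h) ∷ totalMeeting≡0 k t Qs x (ℕ.m+n≡0⇒n≡0 ⟦ t ≤? ∥ Q ∩ transversal k x ∥ ⟧ h)

-- For a random transversal, the expected number of listed sets with at least `t` hits is at most
-- `length Qs * (w / n)ᵗ < 1`, so some transversal has no such set.
avoidingTransversal : ∀ {n} k t w (Qs : List (Subset (k ℕ.* n))) .{{_ : ℕ.NonZero n}} →
  All (λ Q → ∥ Q ∥ ℕ.≤ w) Qs →
  length Qs ℕ.* w ℕ.^ t ℕ.< n ℕ.^ t → Σ (Vec (Fin n) k) λ x → All (λ Q → ∥ Q ∩ transversal k x ∥ ℕ.< t) Qs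
avoidingTransversal {n} k t w Qs Qs≤w few = x , totalMeeting≡0 k t Qs x zero-meeting
  where
  instance _ = ℕ.m^n≢0 n k
  total< : sumFunctions k (totalMeeting k t Qs) ℕ.< n ℕ.^ k
  total< = ℕ.*-cancelʳ-< (n ℕ.^ t) _ _ (ℕ.≤-<-trans (totalMeeting-bound k t w Qs Qs≤w)
    (subst (length Qs ℕ.* w ℕ.^ t ℕ.* n ℕ.^ k ℕ.<_) (ℕ.*-comm (n ℕ.^ t) (n ℕ.^ k)) (ℕ.*-monoˡ-< (n ℕ.^ k) few)))
  found = sumFunctions-pigeonhole k (totalMeeting k t Qs) total<
  x = proj₁ found
  zero-meeting = proj₂ found

-- Runs of an algorithm

queried : ∀ {d} → Strategy d → SetFunction d → List (Subset d)
queried (output S)  F = []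
queried (query S κ) F = S ∷ queried (κ (F S)) F

length-queried : ∀ {d} (σ : Strategy d) F → length (queried σ F) ≡ queryCount σ F
length-queried (output S)  F = refl
length-queried (query S κ) F = cong suc (length-queried (κ (F S)) F)

-- Equal answers select the same branch. The equality is propositional because a strategy sees the
-- sequence that represents a real, and could branch differently on sequences related by `_≈ℝ_`.
run-cong : ∀ {d} (σ : Strategy d) {F G : SetFunction d} →
  All (λ Q → F Q ≡ G Q) (queried σ F) → run σ F ≡ run σ G
run-cong (output S)  _ = refl
run-cong (query S κ) {F} {G} (FS≡GS ∷ F≡G) =
  trans (run-cong (κ (F S)) F≡G) (cong (λ y → run (κ y) G) FS≡GS)

-- Hiding a `k`-set from the queries.

module Hiding (κ : ℚ) (0≤κ : 0ℚ ≤ κ) (κ≤1 : κ ≤ 1ℚ) (r k : ℕ) (kκ≡1 : ι k * κ ≡ 1ℚ) (1≤k : 1 ℕ.≤ k) where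

  open Powers κ 0≤κ κ≤1
  open Values κ 0≤κ κ≤1 r k kκ≡1
  open SetValues κ 0≤κ κ≤1 r k kκ≡1 1≤k

  value-hidden : ∀ {d} (O S : Subset d) → ∥ S ∥ ℕ.≤ k ℕ.+ k → ∥ S ∩ O ∥ ℕ.≤ r → value O S ≡ 1ℚ - q ^ ∥ S ∥
  value-hidden O S S≤2k S∩O≤r = trans (value-small O S S≤2k)
    (trans (g-hidden ∥ S ∩ ∁ O ∥ S∩O≤r) (cong (λ n → 1ℚ - q ^ n) (∥∩∥+∥∩∁∥ S O)))

  -- Hiding the empty set gives a reference function chosen before `O`. With few hits, a small set
  -- has under both functions the value determined by its size; large sets have value 1 under both.
  value-indistinguishable : ∀ {d} (O S : Subset d) →
    (∥ S ∥ ℕ.≤ k ℕ.+ k → ∥ S ∩ O ∥ ℕ.≤ r) → value ⊥ S ≡ value O S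
  value-indistinguishable {d} O S S∩O≤r with ∥ S ∥ ℕ.≤? k ℕ.+ k
  ... | yes S≤2k = trans
    (value-hidden ⊥ S S≤2k (subst (ℕ._≤ r) (sym (trans (cong ∥_∥ (∩-zeroʳ S)) (∣⊥∣≡0 d))) z≤n))
    (sym (value-hidden O S S≤2k (S∩O≤r S≤2k)))
  ... | no  S≰2k = trans (value-large ⊥ S S≰2k) (sym (value-large O S S≰2k))

  value-optimum : ∀ {d} (O : Subset d) → ∥ O ∥ ≡ k → 1ℚ - ι r * κ ≤ value O O
  value-optimum O O≡k = begin
    1ℚ - ι r * κ                        ≤⟨ ℚ.+-monoʳ-≤ 1ℚ (ℚ.neg-antimono-≤ rem≤) ⟩
    1ℚ - remaining a * discount a c     ≡⟨ sym (value-small O O O≤2k) ⟩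
    value O O                           ∎
    where
    open ℚ.≤-Reasoning
    a = ∥ O ∩ O ∥
    c = ∥ O ∩ ∁ O ∥
    O≤2k : ∥ O ∥ ℕ.≤ k ℕ.+ k
    O≤2k = subst (ℕ._≤ k ℕ.+ k) (sym O≡k) (ℕ.m≤m+n k k)
    a≡k : a ≡ k
    a≡k = trans (cong ∥_∥ (∩-idem O)) O≡k
    -- Stated as an inequality, this also covers `r > k`, where the truncated difference is 0.
    k≤r+[k∸r] : ι k ≤ ι r + ι (k ℕ.∸ r)
    k≤r+[k∸r] = subst (ι k ≤_) (ι-+ r (k ℕ.∸ r)) (ι-mono (ℕ.m≤n+m∸n k r))
    rem≤ : remaining a * discount a c ≤ ι r * κ
    rem≤ = begin
      remaining a * discount a c
        ≤⟨ *-monoˡ (remaining a) (0≤remaining (ℕ.≤-reflexive a≡k)) (q^≤1 (a ℕ.⊓ r ℕ.+ c)) ⟩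
      remaining a * 1ℚ               ≡⟨ ℚ.*-identityʳ (remaining a) ⟩
      remaining a                    ≡⟨ cong remaining a≡k ⟩
      1ℚ - ι (k ℕ.∸ r) * κ           ≡⟨ cong (_- ι (k ℕ.∸ r) * κ) (sym kκ≡1) ⟩
      ι k * κ - ι (k ℕ.∸ r) * κ      ≤⟨ ℚ.+-monoˡ-≤ (- (ι (k ℕ.∸ r) * κ)) (*-monoʳ κ 0≤κ k≤r+[k∸r]) ⟩
      (ι r + ι (k ℕ.∸ r)) * κ - ι (k ℕ.∸ r) * κ
        ≡⟨ solve 3 (λ x y κ → (x :+ y) :* κ :- y :* κ := x :* κ) refl (ι r) (ι (k ℕ.∸ r)) κ ⟩
      ι r * κ                        ∎

  -- Queries above size `2k` reveal nothing and are filtered out, so the union bound runs with width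
  -- `2k`. Its threshold is `suc r`, since `r` hits are harmless.
  hide : ∀ {n} .{{_ : ℕ.NonZero n}} (Qs : List (Subset (k ℕ.* n))) →
    length Qs ℕ.* (k ℕ.+ k) ℕ.^ suc r ℕ.< n ℕ.^ suc r →
    Σ (Subset (k ℕ.* n)) λ O → ∥ O ∥ ≡ k × All (λ Q → ∥ Q ∥ ℕ.≤ k ℕ.+ k → ∥ Q ∩ O ∥ ℕ.≤ r) Qs
  hide {n} Qs few = transversal k x , ∥transversal∥ k x , All.tabulate λ Q∈Qs Q≤2k →
      ℕ.s≤s⁻¹ (All.lookup avoids (∈-filter⁺ small? Q∈Qs Q≤2k))
    where
    small? = λ (Q : Subset (k ℕ.* n)) → ∥ Q ∥ ℕ.≤? k ℕ.+ k
    found = avoidingTransversal k (suc r) (k ℕ.+ k) (filter small? Qs) (All.all-filter small? Qs)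
      (ℕ.≤-<-trans (ℕ.*-monoˡ-≤ ((k ℕ.+ k) ℕ.^ suc r) (List.length-filter small? Qs)) few)
    x = proj₁ found
    avoids = proj₂ found

-- The limit argument

-- Here `y` approximates the guarantee, `v` is the optimum, `w` is `q` to the size of the output,
-- `x` is `rκ`, and `η = ε/8`. The estimates give `y ≥ 1 - w + ε - 2η`; multiplication by
-- `v ≥ 1 - x` costs another `η`; so `y * v ≤ 1 - w + η` would force `ε ≤ 4η = ε/2`.
too-good : ∀ {ε Eₙ Eₘ error qᵏ w x v y} → let η = ½ * ½ * ½ * ε in
  0ℚ < ε → 1ℚ - Eₙ + ε ≤ y → Eₙ ≤ Eₘ + η → Eₘ ≤ qᵏ + error → error ≤ η →
  qᵏ ≤ w → 0ℚ ≤ w → w ≤ 1ℚ → 0ℚ ≤ x → (1ℚ + ε) * x ≤ η → 0ℚ ≤ v → 1ℚ - x ≤ v → ¬ (y * v ≤ 1ℚ - w + η)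
too-good {ε} {Eₙ} {Eₘ} {err} {qᵏ} {w} {x} {v} {y} 0<ε E≤y Eₙ≤ Eₘ≤ err≤ qᵏ≤w 0≤w w≤1 0≤x x≤ 0≤v v≥ yv≤ =
  ℚ.<-irrefl refl (ℚ.<-≤-trans (ℚ.*-monoʳ-<-pos ½ 0<ε) ½ε≤0)
  where
  open ℚ.≤-Reasoning
  η = ½ * ½ * ½ * ε
  0≤ε : 0ℚ ≤ ε
  0≤ε = ℚ.<⇒≤ 0<ε
  z = 1ℚ - w + ε - η - η
  z≤y : z ≤ y
  z≤y = 0≤-⇒≤ (subst (0ℚ ≤_)
    (solve 8 (λ ε Eₙ Eₘ err qᵏ w y η →
        (y :- (con 1ℚ :- Eₙ :+ ε)) :+ ((Eₘ :+ η) :- Eₙ) :+ ((qᵏ :+ err) :- Eₘ) :+ (η :- err) :+ (w :- qᵏ)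
        := y :- (con 1ℚ :- w :+ ε :- η :- η)) refl ε Eₙ Eₘ err qᵏ w y η)
    (0≤+ (0≤+ (0≤+ (0≤+ (≤⇒0≤- E≤y) (≤⇒0≤- Eₙ≤)) (≤⇒0≤- Eₘ≤)) (≤⇒0≤- err≤)) (≤⇒0≤- qᵏ≤w)))
  0≤η : 0ℚ ≤ η
  0≤η = 0≤* (0≤* (0≤* 0≤½ 0≤½) 0≤½) 0≤ε
  0≤z : 0ℚ ≤ z
  0≤z = subst (0ℚ ≤_)
    (solve 2 (λ ε w → (con 1ℚ :- w) :+ (con ½ :+ con ½ :* con ½) :* ε
                      := con 1ℚ :- w :+ ε :- con ½ :* con ½ :* con ½ :* ε :- con ½ :* con ½ :* con ½ :* ε) refl
      ε w)
    (0≤+ (≤⇒0≤- w≤1) (0≤* (0≤+ 0≤½ (0≤* 0≤½ 0≤½)) 0≤ε))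
  z≤1+ε : z ≤ 1ℚ + ε
  z≤1+ε = ≤-offset (w + η + η) (0≤+ (0≤+ 0≤w 0≤η) 0≤η)
    (solve 3 (λ w ε η → con 1ℚ :+ ε := con 1ℚ :- w :+ ε :- η :- η :+ (w :+ η :+ η)) refl w ε η)
  z-η≤yv : z - η ≤ 1ℚ - w + η
  z-η≤yv = begin
    z - η             ≤⟨ ℚ.+-monoʳ-≤ z (ℚ.neg-antimono-≤ (ℚ.≤-trans (*-monoʳ x 0≤x z≤1+ε) x≤)) ⟩
    z - z * x         ≡⟨ solve 2 (λ z x → z :- z :* x := z :* (con 1ℚ :- x)) refl z x ⟩
    z * (1ℚ - x)      ≤⟨ *-monoˡ z 0≤z v≥ ⟩
    z * v             ≤⟨ *-monoʳ v 0≤v z≤y ⟩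
    y * v             ≤⟨ yv≤ ⟩
    1ℚ - w + η        ∎
  ½ε≤0 : ½ * ε ≤ 0ℚ
  ½ε≤0 = begin
    ½ * ε
      ≡⟨ solve 2 (λ ε w → con ½ :* ε := (con 1ℚ :- w :+ ε :- e ε :- e ε :- e ε) :- (con 1ℚ :- w :+ e ε)) refl
           ε w ⟩
    (z - η) - (1ℚ - w + η)
      ≤⟨ ℚ.+-monoˡ-≤ (- (1ℚ - w + η)) z-η≤yv ⟩
    (1ℚ - w + η) - (1ℚ - w + η)
      ≡⟨ ℚ.+-inverseʳ (1ℚ - w + η) ⟩
    0ℚ ∎
    where
    e = λ ε → con ½ :* con ½ :* con ½ :* ε

b≤½ : ∀ {b c₁ : ℝ} {κ} → 0ℚ ≤ κ → 0ℝ <ℝ c₁ → c₁ *ℝ fromℚ κ ≤ℝ ½ℝ -ℝ b → b ≤ℝ ½ℝ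
b≤½ {b} {c₁} {κ} 0≤κ (δ , 0<δ , N , δ≤c₁) c₁κ≤ ε 0<ε with c₁κ≤ ε 0<ε
... | N′ , bound = N ℕ.⊔ N′ , λ n ≤n →
  let 0≤c₁ : 0ℚ ≤ seq c₁ n
      0≤c₁ = ℚ.≤-trans (ℚ.<⇒≤ 0<δ) (subst (_≤ seq c₁ n) (ℚ.+-identityˡ δ) (δ≤c₁ n (ℕ.m⊔n≤o⇒m≤o N N′ ≤n)))
  in 0≤-⇒≤ (subst (0ℚ ≤_)
       (solve 3 (λ b x ε → ((con ½ :- b) :+ ε :- x) :+ x := con ½ :+ ε :- b) refl (seq b n) (seq c₁ n * κ) ε)
       (0≤+ (≤⇒0≤- (bound n (ℕ.m⊔n≤o⇒n≤o N N′ ≤n))) (0≤* 0≤c₁ 0≤κ)))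

^-distribʳ-* : ∀ r m n → (m ℕ.* n) ℕ.^ r ≡ m ℕ.^ r ℕ.* n ℕ.^ r
^-distribʳ-* zero    m n = refl
^-distribʳ-* (suc r) m n = trans (cong (m ℕ.* n ℕ.*_) (^-distribʳ-* r m n))
  (ℕ-solve 4 (λ m n M N → (m ⊗ n) ⊗ (M ⊗ N) ⊜ (m ⊗ M) ⊗ (n ⊗ N)) refl m n (m ℕ.^ r) (n ℕ.^ r))

-- The left side grows like `nʳ` and the right side like `nʳ⁺¹`, so it is enough that `n` exceeds
-- the coefficient. The leading `suc` makes room for the output set.
few-queries : ∀ c r k w → let n = suc ((1 ℕ.+ c ℕ.* k ℕ.^ r) ℕ.* w ℕ.^ suc r) in
  suc (c ℕ.* (k ℕ.* n) ℕ.^ r) ℕ.* w ℕ.^ suc r ℕ.< n ℕ.^ suc r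
few-queries c r k w = begin-strict
  (1 ℕ.+ c ℕ.* (k ℕ.* n) ℕ.^ r) ℕ.* W
    ≡⟨ cong (λ m → (1 ℕ.+ c ℕ.* m) ℕ.* W) (^-distribʳ-* r k n) ⟩
  (1 ℕ.+ c ℕ.* (k ℕ.^ r ℕ.* n ℕ.^ r)) ℕ.* W
    ≤⟨ ℕ.*-monoˡ-≤ W (ℕ.+-monoˡ-≤ (c ℕ.* (k ℕ.^ r ℕ.* n ℕ.^ r)) (ℕ.m^n>0 n r)) ⟩
  (n ℕ.^ r ℕ.+ c ℕ.* (k ℕ.^ r ℕ.* n ℕ.^ r)) ℕ.* W
    ≡⟨ ℕ-solve 4 (λ N c K W → (N ⊕ c ⊗ (K ⊗ N)) ⊗ W ⊜ ((ℕ-con 1 ⊕ c ⊗ K) ⊗ W) ⊗ N) refl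
         (n ℕ.^ r) c (k ℕ.^ r) W ⟩
  ((1 ℕ.+ c ℕ.* k ℕ.^ r) ℕ.* W) ℕ.* n ℕ.^ r
    <⟨ ℕ.*-monoˡ-< (n ℕ.^ r) {{ℕ.m^n≢0 n r}} (ℕ.n<1+n ((1 ℕ.+ c ℕ.* k ℕ.^ r) ℕ.* W)) ⟩
  n ℕ.^ suc r ∎
  where
  open ℕ.≤-Reasoning
  W = w ℕ.^ suc r
  n = suc ((1 ℕ.+ c ℕ.* k ℕ.^ r) ℕ.* W)

theorem4 : (b : ℕ → ℝ) → IsHalfMinusΘ[1/k] b →
    (α : ℝ) → 1ℝ -ℝ e⁻¹ <ℝ α →
    ¬ (Σ Algorithm λ A → PolynomiallyManyQueries b A × AchievesGuarantee b A α)
theorem4 b (c₁ , c₂ , k₀ , 0<c₁ , 0<c₂ , Θ) α (ε , 0<ε , N₁ , 1-e⁻¹+ε≤α) (A , (c , r , poly) , guarantee) =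
  too-good 0<ε (1-e⁻¹+ε≤α m N₁≤m) Eₙ≤ (expPartialSum-double≤ kκ≡1 N₂ N₂≤k) (small-κ K₁ K₁≤k)
    (q^-antitone S₀≤k) (0≤q^ ∥ S₀ ∥) (q^≤1 ∥ S₀ ∥) (0≤* (0≤ι r) 0≤κ)
    (subst (_≤ η) (ℚ.*-assoc (1ℚ + ε) (ι r) κ) (small-κ K₂ K₂≤k))
    0≤v v≥ (subst (λ z → seq α m * v ≤ z + η) S₀-value (guaranteed m N₃≤m))
  where
  η = ½ * ½ * ½ * ε
  0<η : 0ℚ < η
  0<η = ℚ.*-monoʳ-<-pos (½ * ½ * ½) 0<ε
  e⁻¹-cauchy = cauchy e⁻¹ η 0<η
  N₂ = proj₁ e⁻¹-cauchy
  K₁ = archimedean (sumError (double N₂)) 0<η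
  K₂ = archimedean ((1ℚ + ε) * ι r) 0<η
  -- Large enough for the Θ bounds, for a truncation of length `double N₂ ≤ k`, and, through `K₁`
  -- and `K₂`, for making `sumError (double N₂) / k` and `(1 + ε) r / k` at most `η`.
  k′ = k₀ ℕ.+ double N₂ ℕ.+ proj₁ K₁ ℕ.+ proj₁ K₂
  k = suc k′
  K₂≤k : proj₁ K₂ ℕ.≤ k
  K₂≤k = ℕ.m≤n⇒m≤1+n (ℕ.m≤n+m (proj₁ K₂) _)
  K₁≤k : proj₁ K₁ ℕ.≤ k
  K₁≤k = ℕ.m≤n⇒m≤1+n (ℕ.m≤n⇒m≤n+o (proj₁ K₂) (ℕ.m≤n+m (proj₁ K₁) _))
  N₂≤k : double N₂ ℕ.≤ k
  N₂≤k = ℕ.m≤n⇒m≤1+n (ℕ.m≤n⇒m≤n+o (proj₁ K₂) (ℕ.m≤n⇒m≤n+o (proj₁ K₁) (ℕ.m≤n+m (double N₂) k₀)))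
  k₀≤k : k₀ ℕ.≤ k
  k₀≤k = ℕ.m≤n⇒m≤1+n (ℕ.m≤n⇒m≤n+o (proj₁ K₂) (ℕ.m≤n⇒m≤n+o (proj₁ K₁) (ℕ.m≤m+n k₀ (double N₂))))
  κ = + 1 / k
  0≤κ : 0ℚ ≤ κ
  0≤κ = 0≤1/ k′
  κ≤1 : κ ≤ 1ℚ
  κ≤1 = 1/suc≤1 k′
  kκ≡1 : ι k * κ ≡ 1ℚ
  kκ≡1 = ι-inverse k′
  open Powers κ 0≤κ κ≤1
  open Binomial κ 0≤κ κ≤1
  -- The exponent of the query bound doubles as the number of harmless hits: `r + 1` hits have
  -- probability of order `n⁻ʳ⁻¹`, which outweighs order `nʳ` queries.
  open SetValues κ 0≤κ κ≤1 r k kκ≡1 (s≤s z≤n)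
  open Hiding κ 0≤κ κ≤1 r k kκ≡1 (s≤s z≤n)

  small-κ : ∀ {p} (K : ∃[ n ] (∀ m → n ℕ.≤ m → p ≤ η * ι m)) → proj₁ K ℕ.≤ k → p * κ ≤ η
  small-κ {p} K K≤k = begin
    p * κ            ≤⟨ *-monoʳ κ 0≤κ (proj₂ K k K≤k) ⟩
    η * ι k * κ      ≡⟨ ℚ.*-assoc η (ι k) κ ⟩
    η * (ι k * κ)    ≡⟨ cong (η *_) kκ≡1 ⟩
    η * 1ℚ           ≡⟨ ℚ.*-identityʳ η ⟩
    η                ∎
    where open ℚ.≤-Reasoning

  n = suc ((1 ℕ.+ c ℕ.* k ℕ.^ r) ℕ.* (k ℕ.+ k) ℕ.^ suc r)
  d = k ℕ.* n

  bk≤½ : b k ≤ℝ ½ℝ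
  bk≤½ = b≤½ {b k} {c₁} 0≤κ 0<c₁ (proj₁ (Θ k k₀≤k))

  ∥⊥∥≤k : ∥ ⊥ {d} ∥ ℕ.≤ k
  ∥⊥∥≤k = subst (ℕ._≤ k) (sym (∣⊥∣≡0 d)) z≤n

  -- The run on `F₀` fixes the queries before `O` is chosen. `F₀` must itself be in the class, since
  -- the query bound is promised only there.
  F₀ = valueFunction {d} ⊥ ∥⊥∥≤k
  F₀∈class : InClass b k F₀
  F₀∈class = inClass ⊥ ∥⊥∥≤k b bk≤½
  S₀ = run (A d k) F₀
  S₀≤k : ∥ S₀ ∥ ℕ.≤ k
  S₀≤k = proj₁ (guarantee d k F₀ F₀∈class)
  -- The output is listed with the queries so that `O` nearly avoids it too, which keeps its value
  -- low.
  Qs = S₀ ∷ queried (A d k) F₀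

  few : length Qs ℕ.* (k ℕ.+ k) ℕ.^ suc r ℕ.< n ℕ.^ suc r
  few = ℕ.≤-<-trans
    (ℕ.*-monoˡ-≤ ((k ℕ.+ k) ℕ.^ suc r)
      (s≤s (subst (ℕ._≤ c ℕ.* d ℕ.^ r) (sym (length-queried (A d k) F₀)) (poly d k F₀ F₀∈class))))
    (few-queries c r k (k ℕ.+ k))

  hidden = hide {n} Qs few
  O = proj₁ hidden
  O≡k = proj₁ (proj₂ hidden)
  O≤k = ℕ.≤-reflexive O≡k
  avoids = proj₂ (proj₂ hidden)

  F = valueFunction O O≤k
  F∈class : InClass b k F
  F∈class = inClass O O≤k b bk≤½

  same-run : S₀ ≡ run (A d k) F
  same-run = run-cong (A d k) (All.map (λ {Q} h → cong fromℚ (value-indistinguishable O Q h)) (All.tail avoids))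

  S₀-value : value O S₀ ≡ 1ℚ - q ^ ∥ S₀ ∥
  S₀-value = let S₀≤2k = ℕ.m≤n⇒m≤n+o k S₀≤k in value-hidden O S₀ S₀≤2k (All.head avoids S₀≤2k)

  best = proj₁ (maximum O O≤k)
  best≤k = proj₁ (proj₂ (maximum O O≤k))
  best-max = proj₂ (proj₂ (maximum O O≤k))
  v = value O best
  v-max : IsMaximum F k (fromℚ v)
  v-max = (best , best≤k , fromℚ-mono ℚ.≤-refl , fromℚ-mono ℚ.≤-refl) , λ S S≤k → fromℚ-mono (best-max S S≤k)
  0≤v : 0ℚ ≤ v
  0≤v = subst (_≤ v) (value-⊥ O) (best-max ⊥ ∥⊥∥≤k)
  v≥ : 1ℚ - ι r * κ ≤ v
  v≥ = ℚ.≤-trans (value-optimum O O≡k) (best-max O O≤k)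

  αv≤ : α *ℝ fromℚ v ≤ℝ fromℚ (value O S₀)
  αv≤ = subst (λ S → α *ℝ fromℚ v ≤ℝ F S) (sym same-run) (proj₂ (guarantee d k F F∈class) (fromℚ v) v-max)
  N₃ = proj₁ (αv≤ η 0<η)
  guaranteed = proj₂ (αv≤ η 0<η)

  -- An index at which the gap above `1 - e⁻¹`, the Cauchy estimate for `e⁻¹` and the guarantee up
  -- to `η` hold together.
  m = N₁ ℕ.+ N₂ ℕ.+ N₃
  N₃≤m : N₃ ℕ.≤ m
  N₃≤m = ℕ.m≤n+m N₃ _
  N₂≤m : N₂ ℕ.≤ m
  N₂≤m = ℕ.m≤n⇒m≤n+o N₃ (ℕ.m≤n+m N₂ N₁)
  N₁≤m : N₁ ℕ.≤ m
  N₁≤m = ℕ.m≤n⇒m≤n+o N₃ (ℕ.m≤m+n N₁ N₂)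

  Eₙ≤ : expPartialSum m ≤ expPartialSum (double N₂) + η
  Eₙ≤ = begin
    Eₙ               ≡⟨ solve 2 (λ x y → x := y :+ (x :- y)) refl Eₙ Eₘ ⟩
    Eₘ + (Eₙ - Eₘ)   ≤⟨ ℚ.+-monoʳ-≤ Eₘ (p≤∣p∣ (Eₙ - Eₘ)) ⟩
    Eₘ + ∣ Eₙ - Eₘ ∣ ≤⟨ ℚ.+-monoʳ-≤ Eₘ (proj₂ e⁻¹-cauchy m (double N₂) N₂≤m (n≤double N₂)) ⟩
    Eₘ + η           ∎
    where
    open ℚ.≤-Reasoning
    Eₙ = expPartialSum m
    Eₘ = expPartialSum (double N₂)
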